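{- Every $n$-vertex plane graph $G=(V,E)$ has a vertex set $V'\subseteq V$ with $|V'|\ge n/2$ such that the induced plane graph $G[V']$ is an outerplane graph.
   Context: A plane graph is a planar graph together with a plane embedding, i.e., an equivalence class of planar drawings having the same rotation scheme at every vertex, the same facial cycles for every face, and the same outer face. For $V'\subseteq V$, the induced plane graph $G[V']$ is the subgraph of $G$ induced by $V'$ together with the embedding inherited from $G$ (obtained by deleting from the embedding of $G$ all vertices and edges not in $G[V']$). A plane graph is outerplane if all its vertices are incident to its outer face. -}

module Defs where

open import Data.Bool.Base using (if_then_else_)
open import Data.Fin.Base using (Fin)
open import Data.Fin.Properties using (_<?_)
open import Data.Fin.Subset using (Subset; ∣_∣; _∩_)
  renaming (_∈_ to _∈ˢ_; _∉_ to _∉ˢ_)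
open import Data.Fin.Subset.Properties using (_∈?_)
open import Data.List.Base
  using (List; []; _∷_; _++_; map; filter; length; sum; take; allFin)
open import Data.List.Membership.Propositional using (_∈_; _∉_)
open import Data.List.Relation.Unary.Unique.Propositional using (Unique)
open import Data.Nat.Base using (ℕ; suc; _+_)
open import Data.Product.Base using (∃; ∃-syntax; ∃₂; _×_; proj₁)
open import Data.Sum.Base using (_⊎_)
open import Data.Unit.Base using (⊤)
open import Function.Bundles using (Inverse)
open import Level using (0ℓ)
open import Relation.Binary.Bundles using (Setoid)
open import Relation.Binary.Construct.Closure.Equivalence as EqC
  using (EqClosure)
open import Relation.Binary.Core using (Rel)
open import Relation.Binary.PropositionalEquality using (_≡_; setoid)
open import Relation.Nullary.Decidable using (does)
open import Relation.Unary using (Pred)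

-- w follows u immediately in xs, read as a cyclic sequence.
CyclicNext : {A : Set} → List A → A → A → Set
CyclicNext xs u w = ∃₂ λ ps qs → xs ++ take 1 xs ≡ ps ++ u ∷ w ∷ qs

-- A drawing is recorded up to the equivalence that defines plane graphs:
-- by its rotation scheme, the assignment of facial boundaries to faces, and
-- the outer face.  The axioms are in IsPlane.
--
-- The vertices form a subset of Fin N, so that induced subgraphs keep the
-- names of their vertices.  Graphs need not be connected, so one face can be
-- bounded by several closed walks and isolated vertices; hence faces are data,
-- not just orbits of the face-tracing permutation.
record Embedding (N : ℕ) : Set₁ where
  field
    V     : Subset N
    -- Neighbours of a vertex in clockwise order; the starting point of the
    -- list is irrelevant.
    rot   : Fin N → List (Fin N)
    Faces : Setoid 0ℓ 0ℓ

  open Setoid Faces public using (_≈_) renaming (Carrier to Face)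

  field
    -- left u v is the face to the left of the edge uv traversed from u to v;
    -- meaningful only if v ∈ rot u.
    left  : Fin N → Fin N → Face
    -- The face containing an isolated vertex; meaningful only if rot u ≡ [].
    at    : Fin N → Face
    outer : Face

  -- The corners (angles) at a non-isolated vertex u correspond to the edges
  -- leaving u: each such edge has one corner of u immediately to its left.
  Incident : Fin N → Face → Set
  Incident u f = u ∈ˢ V ×
    ((∃[ v ] v ∈ rot u × left u v ≈ f) ⊎ (rot u ≡ [] × at u ≈ f))

  -- f and g are joined by erasing the vertices in P with their edges.
  -- Erased edges need no clause of their own: an edge is erased only together
  -- with one of its ends, and that end is incident to both sides of the edge.
  Merged : Pred (Fin N) 0ℓ → Rel Face 0ℓ
  Merged P f g = f ≈ g ⊎ (∃[ u ] P u × Incident u f × Incident u g)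

  Components : Setoid 0ℓ 0ℓ
  Components = EqC.setoid {A = ∃ (_∈ˢ V)} λ a b → proj₁ b ∈ rot (proj₁ a)

  -- Every edge is counted at its smaller end.
  numEdges : ℕ
  numEdges = sum (map (λ u → length (filter (u <?_) (rot u))) (allFin N))

-- The underlying graph is finite and simple, and the surface obtained by
-- gluing the faces along their boundaries is the sphere.
record IsPlane {N : ℕ} (G : Embedding N) : Set where
  open Embedding G
  field
    rot-unique : ∀ u → Unique (rot u)
    rot-irrefl : ∀ u → u ∉ rot u
    rot-sym    : ∀ {u v} → v ∈ rot u → u ∈ rot v
    rot-vertex : ∀ {u v} → v ∈ rot u → u ∈ˢ V

    -- Keeping a face on the left while walking from u to v, the boundary of
    -- that face continues with the edge clockwise next to vu at v.
    left-walk  : ∀ {u v w} → CyclicNext (rot v) u w → left u v ≈ left v w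

    -- The surface is connected: any two faces are linked by a chain of faces
    -- in which consecutive ones share a vertex.
    connected  : ∀ f g → EqClosure (Merged (λ _ → ⊤)) f g

    -- Euler's formula ∣V∣ + F = ∣E∣ + C + 1, for F faces and C components.
    -- Summing V - E + B = 2 - 2g over the components (B boundaries, genus g),
    -- and using that a connected component-face incidence graph with B edges
    -- has B ≥ C + F - 1, equality says that every g is 0 and that this
    -- incidence graph is a tree, i.e. that the surface is a sphere.
    numFaces      : ℕ
    faces↔        : Inverse Faces (setoid (Fin numFaces))
    numComponents : ℕ
    components↔   : Inverse Components (setoid (Fin numComponents))
    euler         : ∣ V ∣ + numFaces ≡ suc (numEdges + numComponents)

IsOuterplane : {N : ℕ} → Embedding N → Set
IsOuterplane G = IsPlane G × (∀ v → v ∈ˢ V → Incident v outer)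
  where open Embedding G

infix 8 _[_]

-- The induced embedding.  A face of G [ W ] is a union of faces of G together
-- with deleted edges and vertices; it is represented by any of those faces.
_[_] : {N : ℕ} → Embedding N → Subset N → Embedding N
_[_] {N} G W = record
  { V     = V ∩ W
  ; rot   = λ u → if does (u ∈? W) then filter (_∈? W) (rot u) else []
  ; Faces = EqC.setoid (Merged (_∉ˢ W))
  ; left  = left
  ; at    = λ u → corner u (rot u)
  ; outer = outer
  }
  where
  open Embedding G

  -- When a vertex becomes isolated all its corners merge; take the first.
  corner : Fin N → List (Fin N) → Face
  corner u []      = at u
  corner u (v ∷ _) = left u v

-- Call two vertices adjacent if they share a face, and place an extra vertex r
-- in the outer face.  Going around a vertex, consecutive faces share a
-- neighbour, so the vertices can be listed, starting from r, in such a way that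
-- every new vertex v is adjacent to both ends of a tie, i.e. an adjacent pair
-- {a, b} of earlier vertices (possibly a = b = r).  For every prefix with m
-- vertices besides r, and every family of t ties in it, some set D with
-- 2|D| ≤ m + t has D ∪ {r} connected and dominating and hits every tie.  This
-- follows by induction: removing v, replace the ties at v by {a, b} if there
-- are none; by {a, b}, adding v to D, if there are at least two; and if there
-- is just one tie {v, x}, drop it and add x to D.  For the full list and no
-- ties, deleting D opens a way from every other vertex to the outer face.
--
-- That deleting vertices preserves Euler's formula is seen by erasing all edges
-- one by one: each step unites two faces or splits a component, but never does
-- both (the faces on the two sides of a bridge coincide).  In the end there is
-- one face, so a count that starts with equality has exactly one event at every
-- step.

module Submission where

open import Defs
open import Data.Nat.Base using (ℕ; _*_; _≤_)
open import Data.Fin.Subset using (Subset; ∣_∣; _⊆_)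
open import Data.Product.Base using (∃-syntax; _×_)
open import Relation.Binary.PropositionalEquality using (_≡_)

open import Data.Bool.Base using (if_then_else_)
open import Data.Fin.Base using (Fin; zero; suc; combine; punchIn; punchOut; toℕ)
open import Data.Fin.Properties as Fin
  using (_<?_; <-cmp; combine-injective; injective⇒≤; pigeonhole; punchInᵢ≢i;
         punchOut-cong′; punchOut-injective; punchOut-punchIn)
open import Data.Fin.Subset using (inside; outside; ⊥; ⁅_⁆; _∩_; _∪_; _-_)
  renaming (_∈_ to _∈ˢ_; _∉_ to _∉ˢ_)
open import Data.Fin.Subset.Properties
  using (_∈?_; p─q⊆p; p─⊥≡p; p⊂q⇒∣p∣<∣q∣; p⊆p∪q; p⊆q⇒∣p∣≤∣q∣; q⊆p∪q; x∈p∩q⁺; x∈p∩q⁻;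
         x∈p∪q⁻; x∈⁅x⁆; x∈⁅y⁆⇒x≡y; ∉⊥; ⊥⊆)
open import Data.List.Base
  using (List; []; _∷_; _++_; allFin; concatMap; filter; foldr; length; map)
open import Data.List.Membership.Propositional using (_∈_; _∉_; find; lose)
open import Data.List.Membership.Propositional.Properties
  using (∈-++⁺ˡ; ∈-++⁻; ∈-allFin; ∈-concatMap⁺; ∈-concatMap⁻; ∈-filter⁺; ∈-filter⁻; ∈-map⁺; ∈-map⁻)
open import Data.List.Properties using (filter-none; length-++; length-map; map-cong)
open import Data.List.Relation.Unary.All as All using (All; []; _∷_)
open import Data.List.Relation.Unary.AllPairs using ([]; _∷_)
open import Data.List.Relation.Unary.Any as Any using (any?; here; there)
open import Data.List.Relation.Unary.Unique.Propositional using (Unique)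
import Data.List.Relation.Unary.Unique.Propositional.Properties as Unique
open import Data.Maybe.Base using (Maybe; just; nothing)
open import Data.Nat.Base using (zero; suc; _+_; s≤s; s≤s⁻¹; z≤n)
open import Data.Nat.ListAction using (sum)
open import Data.Nat.Properties as ℕ
  using (+-suc; m≤n⇒∃[o]m+o≡n; n<1+n; ≤-refl; ≤-reflexive; ≤-trans; module ≤-Reasoning)
open import Data.Nat.Tactic.RingSolver using (solve-∀)
open import Data.Product.Base using (Σ; ∃; ∃₂; _,_; proj₁; proj₂; swap)
open import Data.Sum.Base as Sum using (_⊎_; inj₁; inj₂; [_,_]′)
open import Data.Unit.Base using (⊤; tt)
open import Data.Vec.Base using ([]; _∷_; here; there)
open import Data.Vec.Properties.WithK using ([]=-irrelevant)
open import Function.Base using (_∘_; _on_; id)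
open import Function.Bundles using (Inverse)
open import Level using (0ℓ)
open import Relation.Binary.Bundles using (Setoid)
open import Relation.Binary.Construct.Closure.Equivalence as EqC using (EqClosure)
open import Relation.Binary.Construct.Closure.ReflexiveTransitive as Star
  using (Star; ε; _◅_; _◅◅_)
open import Relation.Binary.Construct.Closure.Symmetric using (SymClosure; bwd; fwd)
import Relation.Binary.Construct.On as On
open import Relation.Binary.Core using (Rel; _⇒_)
open import Relation.Binary.Definitions using (tri<; tri≈; tri>)
open import Relation.Binary.PropositionalEquality
  using (_≢_; cong; cong₂; isEquivalence; refl; setoid; subst; sym; trans)
open import Relation.Binary.Structures using (IsEquivalence)
open import Relation.Nullary using (¬_; Dec; contradiction; no; yes)
open import Relation.Nullary.Decidable using (_×-dec_; decidable-stable; does; map′; ¬?)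
open import Relation.Unary using (Decidable; Pred)

private variable
  A : Set
  k l N : ℕ

-- Equivalence relations with finitely many classes

record Classes {A : Set} (_~_ : Rel A 0ℓ) (k : ℕ) : Set where
  field
    cls      : A → Fin k
    rep      : Fin k → A
    cls-rep  : ∀ i → cls (rep i) ≡ i
    sound    : ∀ {a b} → a ~ b → cls a ≡ cls b
    complete : ∀ {a b} → cls a ≡ cls b → a ~ b

  ~-dec : ∀ a b → Dec (a ~ b)
  ~-dec a b = map′ complete sound (cls a Fin.≟ cls b)

open Classes

Classes-resp : {R S : Rel A 0ℓ} → R ⇒ S → S ⇒ R → Classes R k → Classes S k
Classes-resp R⇒S S⇒R q = record
  { cls = cls q ; rep = rep q ; cls-rep = cls-rep q
  ; sound = sound q ∘ S⇒R ; complete = R⇒S ∘ complete q }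

-- Used in both directions, it makes the number of classes unique, so counts obtained in different
-- ways can be compared.
Classes-≤ : {R : Rel A 0ℓ} → Classes R k → Classes R l → k ≤ l
Classes-≤ p q = injective⇒≤ {f = cls q ∘ rep p} λ {i} {j} eq →
  trans (sym (cls-rep p i)) (trans (sound p (complete q eq)) (cls-rep p j))

fromInverse : (S : Setoid 0ℓ 0ℓ) → Inverse S (setoid (Fin k)) → Classes (Setoid._≈_ S) k
fromInverse S inv = record
  { cls = to ; rep = from
  ; cls-rep = λ i → inverseˡ S.refl
  ; sound = to-cong
  ; complete = λ eq → S.trans (S.sym (inverseʳ refl)) (S.trans (from-cong eq) (inverseʳ refl)) }
  where
  open Inverse inv
  module S = Setoid S

toInverse : (S : Setoid 0ℓ 0ℓ) → Classes (Setoid._≈_ S) k → Inverse S (setoid (Fin k))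
toInverse S q = record
  { to = cls q ; from = rep q ; to-cong = sound q
  ; from-cong = λ { refl → S.refl }
  ; inverse = (λ eq → trans (sound q eq) (cls-rep q _))
            , (λ { refl → complete q (cls-rep q _) }) }
  where module S = Setoid S

Classes-≡ : ∀ {n} → Classes {A = Fin n} _≡_ n
Classes-≡ = record
  { cls = id ; rep = id ; cls-rep = λ _ → refl ; sound = id ; complete = id }

-- Uniting classes along a list of pairs

Join : Rel A 0ℓ → A → A → Rel A 0ℓ
Join _~_ x y a b = a ~ b ⊎ (a ~ x × y ~ b) ⊎ (a ~ y × x ~ b)

module _ {_~_ : Rel A 0ℓ} (eqv : IsEquivalence _~_) where
  private module E = IsEquivalence eqv

  -- Transitivity holds because a chain passing between `x` and `y` twice can be replaced by one
  -- that does not pass between them at all.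
  Join-isEquivalence : ∀ x y → IsEquivalence (Join _~_ x y)
  Join-isEquivalence x y = record
    { refl = inj₁ E.refl
    ; sym = λ { (inj₁ p) → inj₁ (E.sym p)
              ; (inj₂ (inj₁ (p , q))) → inj₂ (inj₂ (E.sym q , E.sym p))
              ; (inj₂ (inj₂ (p , q))) → inj₂ (inj₁ (E.sym q , E.sym p)) }
    ; trans = tr }
    where
    tr : ∀ {a b c} → Join _~_ x y a b → Join _~_ x y b c → Join _~_ x y a c
    tr (inj₁ p) (inj₁ q) = inj₁ (E.trans p q)
    tr (inj₁ p) (inj₂ (inj₁ (q , r))) = inj₂ (inj₁ (E.trans p q , r))
    tr (inj₁ p) (inj₂ (inj₂ (q , r))) = inj₂ (inj₂ (E.trans p q , r))
    tr (inj₂ (inj₁ (p , q))) (inj₁ r) = inj₂ (inj₁ (p , E.trans q r))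
    tr (inj₂ (inj₂ (p , q))) (inj₁ r) = inj₂ (inj₂ (p , E.trans q r))
    tr (inj₂ (inj₁ (p , q))) (inj₂ (inj₁ (r , s))) =
      inj₁ (E.trans p (E.trans (E.sym (E.trans q r)) s))
    tr (inj₂ (inj₁ (p , q))) (inj₂ (inj₂ (r , s))) = inj₁ (E.trans p s)
    tr (inj₂ (inj₂ (p , q))) (inj₂ (inj₁ (r , s))) = inj₁ (E.trans p s)
    tr (inj₂ (inj₂ (p , q))) (inj₂ (inj₂ (r , s))) =
      inj₁ (E.trans p (E.trans (E.sym (E.trans q r)) s))

  Join-min : {_≃_ : Rel A 0ℓ} → IsEquivalence _≃_ → ∀ {x y} → _~_ ⇒ _≃_ → x ≃ y →
             Join _~_ x y ⇒ _≃_
  Join-min eqv′ inc xy = λ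
    { (inj₁ p) → inc p
    ; (inj₂ (inj₁ (p , q))) → E′.trans (inc p) (E′.trans xy (inc q))
    ; (inj₂ (inj₂ (p , q))) → E′.trans (inc p) (E′.trans (E′.sym xy) (inc q)) }
    where module E′ = IsEquivalence eqv′

  Classes-Join-≁ : Classes _~_ (suc k) → ∀ {x y} → ¬ x ~ y → Classes (Join _~_ x y) k
  Classes-Join-≁ {k = k} q {x} {y} x≁y = record
    { cls = c ; rep = rep q ∘ punchIn j
    ; cls-rep = cls-rep′ ; sound = sound′ ; complete = complete′ }
    where
    j = cls q y
    j≢i : j ≢ cls q x
    j≢i eq = x≁y (complete q (sym eq))
    -- y's class is renamed to that of x, and its number is then skipped.
    c : A → Fin k
    c a with j Fin.≟ cls q a
    ... | yes _ = punchOut j≢i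
    ... | no j≢ = punchOut j≢
    cls-rep′ : ∀ i → c (rep q (punchIn j i)) ≡ i
    cls-rep′ i with j Fin.≟ cls q (rep q (punchIn j i))
    ... | yes eq = contradiction (sym (trans eq (cls-rep q _))) (punchInᵢ≢i j i)
    ... | no j≢ = trans (punchOut-cong′ j (cls-rep q _)) (punchOut-punchIn j)
    c-~ : ∀ {a b} → a ~ b → c a ≡ c b
    c-~ {a} {b} p with j Fin.≟ cls q a | j Fin.≟ cls q b
    ... | yes _ | yes _ = refl
    ... | yes e | no n = contradiction (trans e (sound q p)) n
    ... | no n | yes e = contradiction (trans e (sym (sound q p))) n
    ... | no n | no n′ = punchOut-cong′ j (sound q p)
    c-xy : c x ≡ c y
    c-xy with j Fin.≟ cls q x | j Fin.≟ cls q y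
    ... | yes e | _ = contradiction e j≢i
    ... | no _ | no n = contradiction refl n
    ... | no _ | yes _ = punchOut-cong′ j refl
    sound′ : ∀ {a b} → Join _~_ x y a b → c a ≡ c b
    sound′ (inj₁ p) = c-~ p
    sound′ (inj₂ (inj₁ (p , r))) = trans (c-~ p) (trans c-xy (c-~ r))
    sound′ (inj₂ (inj₂ (p , r))) = trans (c-~ p) (trans (sym c-xy) (c-~ r))
    complete′ : ∀ {a b} → c a ≡ c b → Join _~_ x y a b
    complete′ {a} {b} eq with j Fin.≟ cls q a | j Fin.≟ cls q b
    ... | yes e | yes e′ = inj₁ (complete q (trans (sym e) e′))
    ... | yes e | no n = inj₂ (inj₂ (complete q (sym e) , complete q (punchOut-injective j≢i n eq)))
    ... | no n | yes e = inj₂ (inj₁ (complete q (punchOut-injective n j≢i eq) , complete q e))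
    ... | no n | no n′ = inj₁ (complete q (punchOut-injective n n′ eq))

  Classes-Join-~ : Classes _~_ k → ∀ {x y} → x ~ y → Classes (Join _~_ x y) k
  Classes-Join-~ q xy = Classes-resp inj₁ (Join-min eqv id xy) q

  -- In the Euler counts every edge is judged by this dichotomy twice: for the two faces beside it
  -- and for the components of its ends.
  Classes-Join : Classes _~_ k → ∀ x y →
    (x ~ y × Classes (Join _~_ x y) k) ⊎
    (¬ x ~ y × ∃[ k′ ] k ≡ suc k′ × Classes (Join _~_ x y) k′)
  Classes-Join {k = zero} q x y with () ← cls q x
  Classes-Join {k = suc k} q x y with ~-dec q x y
  ... | yes xy = inj₁ (xy , Classes-Join-~ q xy)
  ... | no x≁y = inj₂ (x≁y , k , refl , Classes-Join-≁ q x≁y)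

-- The head of the list is joined last, so that one more pair in front amounts to a single `Join`.
Glue : Rel A 0ℓ → List (A × A) → Rel A 0ℓ
Glue _~_ []            = _~_
Glue _~_ ((x , y) ∷ L) = Join (Glue _~_ L) x y

module _ {_~_ : Rel A 0ℓ} (eqv : IsEquivalence _~_) where

  Glue-isEquivalence : ∀ L → IsEquivalence (Glue _~_ L)
  Glue-isEquivalence []            = eqv
  Glue-isEquivalence ((x , y) ∷ L) = Join-isEquivalence (Glue-isEquivalence L) x y

  Glue-base : ∀ L → _~_ ⇒ Glue _~_ L
  Glue-base []      p = p
  Glue-base (_ ∷ L) p = inj₁ (Glue-base L p)

  Glue-∈ : ∀ {L x y} → (x , y) ∈ L → Glue _~_ L x y
  Glue-∈ {_ ∷ L} (here refl) = inj₂ (inj₁ (E.refl , E.refl))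
    where module E = IsEquivalence (Glue-isEquivalence L)
  Glue-∈ (there p) = inj₁ (Glue-∈ p)

  Glue-min : {_≃_ : Rel A 0ℓ} → IsEquivalence _≃_ → _~_ ⇒ _≃_ →
             ∀ L → (∀ {x y} → (x , y) ∈ L → x ≃ y) → Glue _~_ L ⇒ _≃_
  Glue-min eqv′ inc []      h = inc
  Glue-min eqv′ inc (_ ∷ L) h =
    Join-min (Glue-isEquivalence L) eqv′ (Glue-min eqv′ inc L (h ∘ there)) (h (here refl))

-- Orbits of an injective map on finitely many codes

iterate : (A → A) → ℕ → A → A
iterate f zero    x = x
iterate f (suc n) x = f (iterate f n x)

module _ {n : ℕ} (code : A → Fin n) (f : A → A)
         (f-inj : ∀ {x y} → code (f x) ≡ code (f y) → code x ≡ code y) where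

  private
    cancel : ∀ i j {x} → code (iterate f i x) ≡ code (iterate f (i + j) x) →
             code x ≡ code (iterate f j x)
    cancel zero    j eq = eq
    cancel (suc i) j eq = cancel i j (f-inj eq)

  -- Two of the first n + 1 iterates have equal codes by the pigeonhole principle, and injectivity
  -- cancels the steps up to the earlier one. Points are compared by code only, since the darts to
  -- which this is applied carry proofs.
  returns : ∀ x → ∃[ k ] code x ≡ code (iterate f (suc k) x)
  returns x with i , j , i<j , eq ← pigeonhole (n<1+n n) (λ i → code (iterate f (toℕ i) x))
            with o , i+o≡j ← m≤n⇒∃[o]m+o≡n i<j
    -- The gap between the two iterates is `suc o`, so at least one step is made.
    = o , cancel (toℕ i) (suc o)
            (trans eq (cong (λ m → code (iterate f m x))
              (trans (sym i+o≡j) (sym (+-suc (toℕ i) o)))))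

-- Succession in linear and cyclic lists

data Next {A : Set} : List A → A → A → Set where
  here  : ∀ {u w xs} → Next (u ∷ w ∷ xs) u w
  there : ∀ {x u w xs} → Next xs u w → Next (x ∷ xs) u w

Next⇒split : ∀ {xs : List A} {u w} → Next xs u w → ∃₂ λ ps qs → xs ≡ ps ++ u ∷ w ∷ qs
Next⇒split here      = [] , _ , refl
Next⇒split (there p) with ps , qs , refl ← Next⇒split p = _ ∷ ps , qs , refl

split⇒Next : ∀ (ps : List A) {u w qs} → Next (ps ++ u ∷ w ∷ qs) u w
split⇒Next []       = here
split⇒Next (_ ∷ ps) = there (split⇒Next ps)

-- On a nonempty list `xs ++ take 1 xs` reduces, so cyclic succession is linear succession once the
-- head is repeated at the end.
Next⇒CyclicNext : ∀ {z : A} {zs u w} → Next (z ∷ zs ++ z ∷ []) u w → CyclicNext (z ∷ zs) u w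
Next⇒CyclicNext = Next⇒split

CyclicNext⇒Next : ∀ {z : A} {zs u w} → CyclicNext (z ∷ zs) u w → Next (z ∷ zs ++ z ∷ []) u w
CyclicNext⇒Next (ps , qs , eq) = subst (λ xs → Next xs _ _) (sym eq) (split⇒Next ps)

CyclicNext-[] : ∀ {u w : A} → ¬ CyclicNext [] u w
CyclicNext-[] ([]    , _ , ())
CyclicNext-[] (_ ∷ _ , _ , ())

Next-from-head : ∀ {a y : A} l → y ∈ a ∷ l → Star (Next (a ∷ l)) a y
Next-from-head l       (here refl) = ε
Next-from-head (b ∷ l) (there p)   = here ◅ Star.map there (Next-from-head l p)

Next-to-last : ∀ {x z : A} l → x ∈ l ++ z ∷ [] → Star (Next (l ++ z ∷ [])) x z
Next-to-last []          (here refl) = ε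
Next-to-last (a ∷ [])    (here refl) = here ◅ ε
Next-to-last (a ∷ b ∷ l) (here refl) = here ◅ Star.map there (Next-to-last (b ∷ l) (here refl))
Next-to-last (a ∷ l)     (there p)   = Star.map there (Next-to-last l p)

-- Walk on from `x` to the repeated head at the end, which is also the first entry, and from there
-- to `y`.
CyclicNext-connected : ∀ {xs : List A} {x y} → x ∈ xs → y ∈ xs → Star (CyclicNext xs) x y
CyclicNext-connected {xs = z ∷ zs} x∈ y∈ = Star.map Next⇒CyclicNext
  (Next-to-last (z ∷ zs) (∈-++⁺ˡ x∈) ◅◅ Next-from-head (zs ++ z ∷ []) (∈-++⁺ˡ y∈))

Next-exists : ∀ {u z : A} l → u ∈ l → ∃[ w ] (w ∈ l ⊎ w ≡ z) × Next (l ++ z ∷ []) u w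
Next-exists (a ∷ [])    (here refl) = _ , inj₂ refl , here
Next-exists (a ∷ b ∷ l) (here refl) = _ , inj₁ (there (here refl)) , here
Next-exists (a ∷ l)     (there p) with w , w∈ , n ← Next-exists l p =
  w , Sum.map₁ there w∈ , there n

CyclicNext-exists : ∀ {xs : List A} {u} → u ∈ xs → ∃[ w ] w ∈ xs × CyclicNext xs u w
CyclicNext-exists {xs = z ∷ zs} u∈ with Next-exists {z = z} (z ∷ zs) u∈
... | w , inj₁ w∈   , n = w , w∈ , Next⇒CyclicNext n
... | w , inj₂ refl , n = w , here refl , Next⇒CyclicNext n

Next-∈ʳ : ∀ {a : A} {l u w} → Next (a ∷ l) u w → w ∈ l
Next-∈ʳ here                    = here refl
Next-∈ʳ {l = _ ∷ _} (there n)   = there (Next-∈ʳ n)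

-- Uniqueness is asked of the tail, where all successors lie; in a cyclic list closed up with its
-- head, the head itself occurs twice.
Next-injective : ∀ {a : A} {l u u′ w} → Unique l → Next (a ∷ l) u w → Next (a ∷ l) u′ w → u ≡ u′
Next-injective _          here      here       = refl
Next-injective (b∉ ∷ _)   here      (there n)  = contradiction refl (All.lookup b∉ (Next-∈ʳ n))
Next-injective (b∉ ∷ _)   (there n) here       = contradiction refl (All.lookup b∉ (Next-∈ʳ n))
Next-injective (_ ∷ uniq) (there m) (there n)  = Next-injective uniq m n

CyclicNext-injective : ∀ {xs : List A} {u u′ w} → Unique xs →
                       CyclicNext xs u w → CyclicNext xs u′ w → u ≡ u′
CyclicNext-injective {xs = []}     _           p _ = contradiction p CyclicNext-[]
CyclicNext-injective {xs = z ∷ zs} (z∉ ∷ uniq) p q =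
  Next-injective (Unique.++⁺ uniq ([] ∷ []) λ { (a , here refl) → All.lookup z∉ a refl })
    (CyclicNext⇒Next p) (CyclicNext⇒Next q)

-- A closed walk around a vertex passes each neighbour x from the face g x to
-- the face h (next x).  In this form neighbours can be dropped one at a time.
module _ {_~_ : Rel A 0ℓ} (eqv : IsEquivalence _~_) {B : Set} (g h : B → A) where
  private module E = IsEquivalence eqv

  private
    Walk : A → List B → A → Set
    Walk c []       c′ = c ~ c′
    Walk c (x ∷ xs) c′ = c ~ h x × Walk (g x) xs c′

    Walk-start : ∀ {c d c′} xs → d ~ c → Walk c xs c′ → Walk d xs c′
    Walk-start []       d~c w       = E.trans d~c w
    Walk-start (x ∷ xs) d~c (p , w) = E.trans d~c p , w

    Walk-intro : ∀ z x xs → (∀ {u w} → Next (x ∷ xs ++ z ∷ []) u w → g u ~ h w) →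
                 Walk (g x) xs (h z)
    Walk-intro z x []       H = H here
    Walk-intro z x (y ∷ xs) H = H here , Walk-intro z y xs (H ∘ there)

    Walk-elim : ∀ {c} z x xs → c ~ h z → Walk (g x) xs c →
                ∀ {u w} → Next (x ∷ xs ++ z ∷ []) u w → g u ~ h w
    Walk-elim z x []       c~ w       here      = E.trans w c~
    Walk-elim z x []       c~ w       (there (there ()))
    Walk-elim z x (y ∷ xs) c~ (p , w) here      = p
    Walk-elim z x (y ∷ xs) c~ (p , w) (there n) = Walk-elim z y xs c~ w n

    Walk-filter : ∀ {P : Pred B 0ℓ} (P? : Decidable P) {c c′} xs →
      (∀ {x} → x ∈ xs → ¬ P x → h x ~ g x) → Walk c xs c′ → Walk c (filter P? xs) c′
    Walk-filter P? []       H w = w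
    Walk-filter P? (x ∷ xs) H (p , w) with P? x
    ... | yes _ = p , Walk-filter P? xs (H ∘ there) w
    ... | no ¬p = Walk-start (filter P? xs) (E.trans p (H (here refl) ¬p))
                    (Walk-filter P? xs (H ∘ there) w)

  -- This carries the face-walking axiom over to induced embeddings. There `h x` and `g x` are the
  -- two sides of the edge from the centre to `x`, which become one face when `x` is erased.
  CyclicNext-filter : ∀ {P : Pred B 0ℓ} (P? : Decidable P) xs →
    (∀ {u w} → CyclicNext xs u w → g u ~ h w) →
    (∀ {x} → x ∈ xs → ¬ P x → h x ~ g x) →
    ∀ {u w} → CyclicNext (filter P? xs) u w → g u ~ h w
  CyclicNext-filter P? []       _    _    n = contradiction n CyclicNext-[]
  CyclicNext-filter P? (z ∷ zs) step skip n
    -- The closed walk is cut open at the face `h z`, which remains a valid base point even if `z`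
    -- is dropped.
    with walk ← Walk-filter P? (z ∷ zs) skip (E.refl , Walk-intro z z zs (step ∘ Next⇒CyclicNext))
    with filter P? (z ∷ zs)
  ... | []     = contradiction n CyclicNext-[]
  ... | y ∷ ys = Walk-elim y y ys (proj₁ walk) (proj₂ walk) (CyclicNext⇒Next n)

CyclicNext-∈ʳ : ∀ {xs : List A} {u w} → CyclicNext xs u w → w ∈ xs
CyclicNext-∈ʳ {xs = []}     n = contradiction n CyclicNext-[]
CyclicNext-∈ʳ {xs = z ∷ zs} n with ∈-++⁻ zs (Next-∈ʳ (CyclicNext⇒Next n))
... | inj₁ w∈          = there w∈
... | inj₂ (here refl) = here refl

Classes-Glue : {_~_ : Rel A 0ℓ} → IsEquivalence _~_ → Classes _~_ k →
               ∀ L → ∃ (Classes (Glue _~_ L))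
Classes-Glue eqv q []            = _ , q
Classes-Glue eqv q ((x , y) ∷ L) with _ , r ← Classes-Glue eqv q L
  with Classes-Join (Glue-isEquivalence eqv L) r x y
... | inj₁ (_ , s)         = _ , s
... | inj₂ (_ , _ , _ , s) = _ , s

-- Components of graphs given by edge lists

infix 4 _∈±_

-- Lists hold an undirected edge in one orientation, while adjacency is symmetric.
_∈±_ : A × A → List (A × A) → Set
e ∈± L = e ∈ L ⊎ swap e ∈ L

∈±-there : ∀ {e x : A × A} {L} → e ∈± L → e ∈± x ∷ L
∈±-there = Sum.map there there

-- Components are taken on all of `Fin N`, names outside the vertex set being singletons. Thus the
-- vertex number stays `N` whatever is deleted.
Linked : List (Fin N × Fin N) → Rel (Fin N) 0ℓ
Linked = Glue _≡_

Linked-isEquivalence : (L : List (Fin N × Fin N)) → IsEquivalence (Linked L)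
Linked-isEquivalence = Glue-isEquivalence isEquivalence

Linked-∈± : ∀ {L : List (Fin N × Fin N)} {u v} → (u , v) ∈± L → Linked L u v
Linked-∈±         (inj₁ p) = Glue-∈ isEquivalence p
Linked-∈± {L = L} (inj₂ p) = IsEquivalence.sym (Linked-isEquivalence L) (Glue-∈ isEquivalence p)

Linked-classes : (L : List (Fin N × Fin N)) → ∃ (Classes (Linked L))
Linked-classes = Classes-Glue isEquivalence Classes-≡

Classes-Subset : (U : Subset N) → Classes {A = ∃ (_∈ˢ U)} (_≡_ on proj₁) ∣ U ∣
Classes-Subset [] = record
  { cls = λ () ; rep = λ () ; cls-rep = λ () ; sound = λ { {()} } ; complete = λ { {()} } }
Classes-Subset (outside ∷ U) = record
  { cls      = λ { (suc u , there p) → cls q (u , p) }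
  ; rep      = λ i → suc (proj₁ (rep q i)) , there (proj₂ (rep q i))
  ; cls-rep  = cls-rep q
  ; sound    = λ { {_ , there _} {_ , there _} → sound q ∘ Fin.suc-injective }
  ; complete = λ { {_ , there _} {_ , there _} → cong suc ∘ complete q } }
  where q = Classes-Subset U
Classes-Subset (inside ∷ U) = record
  { cls      = λ { (zero , _) → zero ; (suc u , there p) → suc (cls q (u , p)) }
  ; rep      = λ { zero → zero , here ; (suc i) → suc (proj₁ (rep q i)) , there (proj₂ (rep q i)) }
  ; cls-rep  = λ { zero → refl ; (suc i) → cong suc (cls-rep q i) }
  ; sound    = λ { {_ , here} {_ , here} _ → refl
                 ; {_ , there _} {_ , there _} → cong suc ∘ sound q ∘ Fin.suc-injective }
  ; complete = λ { {_ , here} {_ , here} _ → refl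
                 ; {_ , there _} {_ , there _} → cong suc ∘ complete q ∘ Fin.suc-injective } }
  where q = Classes-Subset U

module _ (U : Subset N) where

  private
    LinkedIn : List (Fin N × Fin N) → Rel (∃ (_∈ˢ U)) 0ℓ
    LinkedIn L = Linked L on proj₁

    LinkedIn-isEquivalence : ∀ L → IsEquivalence (LinkedIn L)
    LinkedIn-isEquivalence L = On.isEquivalence proj₁ (Linked-isEquivalence L)

  -- The counts start at `N` and `∣ U ∣` and drop at the same pairs, because both relations agree on
  -- `U`; their difference never changes.
  Linked-restrict : ∀ L → (∀ {u v} → (u , v) ∈ L → u ∈ˢ U × v ∈ˢ U) →
    ∃₂ λ c d → Classes (Linked L) c × Classes (LinkedIn L) d × c + ∣ U ∣ ≡ d + N
  Linked-restrict [] _ = N , ∣ U ∣ , Classes-≡ , Classes-Subset U , ℕ.+-comm N ∣ U ∣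
  Linked-restrict ((u , v) ∷ L) ends
    with c , d , q , r , eq ← Linked-restrict L (ends ∘ there)
    with u∈ , v∈ ← ends (here refl)
    with Classes-Join (Linked-isEquivalence L) q u v
       | Classes-Join (LinkedIn-isEquivalence L) r (u , u∈) (v , v∈)
  ... | inj₁ (_ , q′)   | inj₁ (_ , r′)   = _ , _ , q′ , r′ , eq
  ... | inj₁ (uv , _)   | inj₂ (¬uv , _)  = contradiction uv ¬uv
  ... | inj₂ (¬uv , _)  | inj₁ (uv , _)   = contradiction uv ¬uv
  ... | inj₂ (_ , _ , refl , q′) | inj₂ (_ , _ , refl , r′) = _ , _ , q′ , r′ , ℕ.suc-injective eq

  module _ {r : Fin N → List (Fin N)} (r-vertex : ∀ {u v} → v ∈ r u → u ∈ˢ U × v ∈ˢ U)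
           {L} (L⇒r : ∀ {u v} → (u , v) ∈ L → v ∈ r u)
           (r⇒L : ∀ {u v} → v ∈ r u → (u , v) ∈± L) where

    private
      Adj : Rel (∃ (_∈ˢ U)) 0ℓ
      Adj a b = proj₁ b ∈ r (proj₁ a)

      -- An extension of the component relation from `U` to all of `Fin N`, so that the minimality
      -- of `Glue` can be applied to it.
      _≃_ : Rel (Fin N) 0ℓ
      u ≃ v = u ≡ v ⊎ Σ (u ∈ˢ U) λ p → Σ (v ∈ˢ U) λ q → EqClosure Adj (u , p) (v , q)

      ≃-isEquivalence : IsEquivalence _≃_
      ≃-isEquivalence = record { refl = inj₁ refl ; sym = sy ; trans = tr }
        where
        sy : ∀ {u v} → u ≃ v → v ≃ u
        sy (inj₁ eq)          = inj₁ (sym eq)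
        sy (inj₂ (p , q , s)) = inj₂ (q , p , EqC.symmetric Adj s)
        tr : ∀ {u v w} → u ≃ v → v ≃ w → u ≃ w
        tr (inj₁ refl) s = s
        tr s (inj₁ refl) = s
        tr (inj₂ (p , q , s)) (inj₂ (q′ , t , s′))
          rewrite []=-irrelevant q′ q = inj₂ (p , t , s ◅◅ s′)

      ≃⇒EqClosure : ∀ {a b} → proj₁ a ≃ proj₁ b → EqClosure Adj a b
      ≃⇒EqClosure {_ , p} {_ , q} (inj₁ refl) rewrite []=-irrelevant q p = ε
      ≃⇒EqClosure {_ , p} {_ , q} (inj₂ (p′ , q′ , s))
        rewrite []=-irrelevant p p′ | []=-irrelevant q q′ = s

    components-Linked : ∀ {d} → Classes (LinkedIn L) d → Classes (EqClosure Adj) d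
    components-Linked = Classes-resp
      (≃⇒EqClosure ∘ Glue-min isEquivalence ≃-isEquivalence inj₁ L
        λ p → inj₂ (proj₁ (r-vertex (L⇒r p)) , proj₂ (r-vertex (L⇒r p)) , EqC.return (L⇒r p)))
      (EqC.fold (LinkedIn-isEquivalence L) (Linked-∈± ∘ r⇒L))

    -- `Linked-restrict` yields one pair of counts with this relation; uniqueness of class counts
    -- transfers it to any given pair.
    components-count : ∀ {c d} → Classes (Linked L) c → Classes (EqClosure Adj) d →
                       c + ∣ U ∣ ≡ d + N
    components-count q s with c , d , q′ , r′ , eq ← Linked-restrict L (r-vertex ∘ L⇒r)
      with refl ← ℕ.≤-antisym (Classes-≤ q q′) (Classes-≤ q′ q)
      with s′ ← components-Linked r′
      with refl ← ℕ.≤-antisym (Classes-≤ s s′) (Classes-≤ s′ s) = eq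

    components-exist : ∃ (Classes (EqClosure Adj))
    components-exist with _ , _ , _ , r′ , _ ← Linked-restrict L (r-vertex ∘ L⇒r) =
      _ , components-Linked r′

-- Edge lists and edge counts

edges : (Fin N → List (Fin N)) → List (Fin N × Fin N)
edges {N} r = concatMap (λ u → map (u ,_) (filter (u <?_) (r u))) (allFin N)

∈-edges⁻ : ∀ (r : Fin N → List (Fin N)) {u v} → (u , v) ∈ edges r → v ∈ r u
∈-edges⁻ r p
  with w , q ← Any.satisfied
    (∈-concatMap⁻ (λ u → map (u ,_) (filter (u <?_) (r u))) {xs = allFin _} p)
  with _ , q′ , refl ← ∈-map⁻ (w ,_) q = proj₁ (∈-filter⁻ (w <?_) q′)

∈-edges⁺ : ∀ {r : Fin N → List (Fin N)} → (∀ u → u ∉ r u) → (∀ {u v} → v ∈ r u → u ∈ r v) →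
           ∀ {u v} → v ∈ r u → (u , v) ∈± edges r
∈-edges⁺ {r = r} irrefl r-sym {u} {v} v∈ with <-cmp u v
... | tri≈ _ refl _ = contradiction v∈ (irrefl u)
... | tri< u<v _ _  = inj₁ (∈-concatMap⁺ _ (Any.map
  (λ { refl → ∈-map⁺ (u ,_) (∈-filter⁺ (u <?_) v∈ u<v) }) (∈-allFin u)))
... | tri> _ _ v<u  = inj₂ (∈-concatMap⁺ _ (Any.map
  (λ { refl → ∈-map⁺ (v ,_) (∈-filter⁺ (v <?_) (r-sym v∈) v<u) }) (∈-allFin v)))

length-edges : ∀ (r : Fin N → List (Fin N)) →
               length (edges r) ≡ sum (map (λ u → length (filter (u <?_) (r u))) (allFin N))
length-edges {N} r = go (allFin N)
  where
  go : ∀ us → length (concatMap (λ u → map (u ,_) (filter (u <?_) (r u))) us) ≡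
              sum (map (λ u → length (filter (u <?_) (r u))) us)
  go []       = refl
  go (u ∷ us) = trans (length-++ (map (u ,_) (filter (u <?_) (r u))))
    (cong₂ _+_ (length-map (u ,_) (filter (u <?_) (r u))) (go us))

sum-map-+ : ∀ (f g : A → ℕ) xs →
            sum (map f xs) + sum (map g xs) ≡ sum (map (λ x → f x + g x) xs)
sum-map-+ f g []       = refl
sum-map-+ f g (x ∷ xs) = trans (interchange (f x) (sum (map f xs)) (g x) (sum (map g xs)))
  (cong (f x + g x +_) (sum-map-+ f g xs))
  where
  interchange : ∀ a b c d → (a + b) + (c + d) ≡ (a + c) + (b + d)
  interchange = solve-∀

length-filter-split : ∀ {P Q : Pred A 0ℓ} (P? : Decidable P) (Q? : Decidable Q) xs →
  length (filter P? (filter (¬? ∘ Q?) xs)) + length (filter P? (filter Q? xs)) ≡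
  length (filter P? xs)
length-filter-split P? Q? [] = refl
length-filter-split P? Q? (x ∷ xs) with Q? x | P? x in eq
... | yes _ | yes _ rewrite eq = trans (+-suc _ _) (cong suc (length-filter-split P? Q? xs))
... | yes _ | no _  rewrite eq = length-filter-split P? Q? xs
... | no _  | yes _ rewrite eq = cong suc (length-filter-split P? Q? xs)
... | no _  | no _  rewrite eq = length-filter-split P? Q? xs

-- Erasing the edges of a plane graph

module Plane {N : ℕ} (G : Embedding N) (plane : IsPlane G) where
  open Embedding G
  open IsPlane plane

  private
    module F = Setoid Faces

    variable
      pre post : List (Fin N × Fin N)
      u v : Fin N

  sides : Fin N × Fin N → Face × Face
  sides (u , v) = left u v , left v u

  -- Faces after erasing the edges in L.
  Opened : List (Fin N × Fin N) → Rel Face 0ℓ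
  Opened L = Glue _≈_ (map sides L)

  Opened-isEquivalence : ∀ L → IsEquivalence (Opened L)
  Opened-isEquivalence L = Glue-isEquivalence F.isEquivalence (map sides L)

  Opened-base : ∀ L → _≈_ ⇒ Opened L
  Opened-base L = Glue-base F.isEquivalence (map sides L)

  Opened-∈± : ∀ {L} → (u , v) ∈± L → Opened L (left u v) (left v u)
  Opened-∈±         (inj₁ p) = Glue-∈ F.isEquivalence (∈-map⁺ sides p)
  Opened-∈± {L = L} (inj₂ p) =
    IsEquivalence.sym (Opened-isEquivalence L) (Glue-∈ F.isEquivalence (∈-map⁺ sides p))

  faceClasses : Classes _≈_ numFaces
  faceClasses = fromInverse Faces faces↔

  Opened-classes : ∀ L → ∃ (Classes (Opened L))
  Opened-classes L = Classes-Glue F.isEquivalence faceClasses (map sides L)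

  Edges : List (Fin N × Fin N) → Set
  Edges L = ∀ {u v} → (u , v) ∈ L → v ∈ rot u

  -- In the course of the erasure `pre` lists the edges already erased and `post` those still
  -- present.
  Cover : (pre post : List (Fin N × Fin N)) → Set
  Cover pre post = ∀ {u v} → v ∈ rot u → (u , v) ∈± pre ⊎ (u , v) ∈± post

  -- Walking along face boundaries from uv, and turning back whenever an edge
  -- into the component X of u is met, permutes the darts that end outside X.
  -- So the walk returns to uv; it then turns back at vu, and before that it
  -- only turns back at erased edges.
  module Bridge {u v} (v∈u : v ∈ rot u) (cover : Cover pre ((u , v) ∷ post))
                (u≁v : ¬ Linked post u v) where

    private
      module L = IsEquivalence (Linked-isEquivalence post)
      module O = IsEquivalence (Opened-isEquivalence pre)

      X : Fin N → Set
      X a = Linked post a u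

      X? : ∀ a → Dec (X a)
      X? a = ~-dec (proj₂ (Linked-classes post)) a u

      Dart : Set
      Dart = Σ (Fin N × Fin N) λ (a , b) → b ∈ rot a × ¬ X b

      code : Dart → Fin (N * N)
      code ((a , b) , _) = combine a b

      face : Dart → Face
      face ((a , b) , _) = left a b

      turn : ∀ {b c} → c ∈ rot b → ¬ X b → Dec (X c) → Dart
      turn {b} {c} c∈ ¬Xb (yes _)  = (c , b) , rot-sym c∈ , ¬Xb
      turn {b} {c} c∈ _   (no ¬Xc) = (b , c) , c∈ , ¬Xc

      -- Whether the walk turned back can be read off the resulting dart: it starts in `X` exactly
      -- in that case.
      turn-injective : ∀ {b c b′ c′} (p : c ∈ rot b) (q : ¬ X b) (d : Dec (X c))
        (p′ : c′ ∈ rot b′) (q′ : ¬ X b′) (d′ : Dec (X c′)) →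
        code (turn p q d) ≡ code (turn p′ q′ d′) → b ≡ b′ × c ≡ c′
      turn-injective {b} {c} {b′} {c′} _ q (yes _) _ q′ (yes _) eq =
        swap (combine-injective c b c′ b′ eq)
      turn-injective {b} {c} {b′} {c′} _ q (no _)  _ q′ (no _)  eq =
        combine-injective b c b′ c′ eq
      turn-injective {b} {c} {b′} {c′} _ q (yes Xc) _ q′ (no _) eq
        with refl , _ ← combine-injective c b b′ c′ eq = contradiction Xc q′
      turn-injective {b} {c} {b′} {c′} _ q (no _) _ q′ (yes Xc) eq
        with refl , _ ← combine-injective b c c′ b′ eq = contradiction Xc q

      onward : ∀ {a b} → b ∈ rot a → ∃[ c ] c ∈ rot b × CyclicNext (rot b) a c
      onward p = CyclicNext-exists (rot-sym p)

      step : Dart → Dart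
      step (_ , p , ¬Xb) = turn (proj₁ (proj₂ (onward p))) ¬Xb (X? (proj₁ (onward p)))

      step-injective : ∀ {d d′} → code (step d) ≡ code (step d′) → code d ≡ code d′
      step-injective {(a , b) , p , ¬Xb} {(a′ , b′) , p′ , ¬Xb′} eq
        with onward p | onward p′
      ... | c , c∈ , n | c′ , c′∈ , n′
        with refl , refl ← turn-injective c∈ ¬Xb (X? c) c′∈ ¬Xb′ (X? c′) eq
        = cong (λ a → combine a b) (CyclicNext-injective (rot-unique b) n n′)

      Done : Set
      Done = Opened pre (left u v) (left v u)

      start : Dart
      start = (u , v) , v∈u , u≁v ∘ L.sym

      -- An edge of `post` cannot leave the component `X`, so an edge between `X` and its complement
      -- is erased or is `uv` itself.
      into-X : ∀ {b c} → c ∈ rot b → ¬ X b → X c →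
               (c , b) ≡ (u , v) ⊎ Opened pre (left c b) (left b c)
      into-X c∈ ¬Xb Xc with cover (rot-sym c∈)
      ... | inj₁ e                   = inj₂ (Opened-∈± e)
      ... | inj₂ (inj₁ (here eq))    = inj₁ eq
      ... | inj₂ (inj₂ (here refl))  = contradiction L.refl ¬Xb
      ... | inj₂ (inj₁ (there e))    = contradiction (L.trans (L.sym (Linked-∈± (inj₁ e))) Xc) ¬Xb
      ... | inj₂ (inj₂ (there e))    = contradiction (L.trans (L.sym (Linked-∈± (inj₂ e))) Xc) ¬Xb

      -- The walk stays in the united face of `left u v` until that face is seen to contain
      -- `left v u`. Every other step ends away from `start`, so the return to `start` forces
      -- `Done`.
      advance : ∀ d → Opened pre (left u v) (face d) →
                Done ⊎ (Opened pre (left u v) (face (step d)) × code start ≢ code (step d))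
      advance ((a , b) , p , ¬Xb) ~d with onward p
      ... | c , c∈ , n with ~bc ← O.trans ~d (Opened-base pre (left-walk n)) with X? c
      ...   | no ¬Xc = inj₂ (~bc , λ eq →
                contradiction (subst X (proj₁ (combine-injective u v b c eq)) L.refl) ¬Xb)
      ...   | yes Xc with into-X c∈ ¬Xb Xc
      ...     | inj₁ refl = inj₁ ~bc
      -- `pre` and `post` may overlap, so the erased edge can be `uv` again; then the far side of
      -- `uv` has been reached.
      ...     | inj₂ cb~bc with c Fin.≟ u | b Fin.≟ v
      ...       | yes refl | yes refl = inj₁ ~bc
      ...       | no c≢u   | _        = inj₂ (O.trans ~bc (O.sym cb~bc) ,
                  λ eq → c≢u (sym (proj₁ (combine-injective u v c b eq))))
      ...       | yes _    | no b≢v   = inj₂ (O.trans ~bc (O.sym cb~bc) ,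
                  λ eq → b≢v (sym (proj₂ (combine-injective u v c b eq))))

      along : ∀ i → Done ⊎ Opened pre (left u v) (face (iterate step i start))
      along zero    = inj₂ O.refl
      along (suc i) = [ inj₁ , Sum.map₂ proj₁ ∘ advance (iterate step i start) ]′ (along i)

    one-face : Opened pre (left u v) (left v u)
    one-face with k , eq ← returns code step step-injective start with along k
    ... | inj₁ done = done
    ... | inj₂ ~d with advance (iterate step k start) ~d
    ...   | inj₁ done        = done
    ...   | inj₂ (_ , start≢) = contradiction eq start≢

  Cover-shift : ∀ {e} → Cover pre (e ∷ post) → Cover (e ∷ pre) post
  Cover-shift cover p with cover p
  ... | inj₁ q                  = inj₁ (∈±-there q)
  ... | inj₂ (inj₁ (here eq))   = inj₁ (inj₁ (here eq))
  ... | inj₂ (inj₂ (here eq))   = inj₁ (inj₂ (here eq))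
  ... | inj₂ (inj₁ (there q))   = inj₂ (inj₁ q)
  ... | inj₂ (inj₂ (there q))   = inj₂ (inj₂ q)

  Cover-unshift : ∀ {e} → Cover (e ∷ pre) post → Cover pre (e ∷ post)
  Cover-unshift cover p with cover p
  ... | inj₂ q                  = inj₂ (∈±-there q)
  ... | inj₁ (inj₁ (here eq))   = inj₂ (inj₁ (here eq))
  ... | inj₁ (inj₂ (here eq))   = inj₂ (inj₂ (here eq))
  ... | inj₁ (inj₁ (there q))   = inj₁ (inj₁ q)
  ... | inj₁ (inj₂ (there q))   = inj₁ (inj₂ q)

  Edges-∷ : ∀ {L} → v ∈ rot u → Edges L → Edges ((u , v) ∷ L)
  Edges-∷ v∈ es (here refl) = v∈
  Edges-∷ v∈ es (there p)   = es p

  corner : ∀ {u v} → v ∈ rot u → ∃[ w ] w ∈ rot u × left v u ≈ left u w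
  corner v∈ with w , w∈ , n ← CyclicNext-exists v∈ = w , w∈ , left-walk n

  Incident-leaving : v ∈ rot u → Incident u (left u v)
  Incident-leaving v∈ = rot-vertex v∈ , inj₁ (_ , v∈ , F.refl)

  Incident-arriving : v ∈ rot u → Incident u (left v u)
  Incident-arriving v∈ with w , w∈ , eq ← corner v∈ = rot-vertex v∈ , inj₁ (w , w∈ , F.sym eq)

  module _ {P : Pred (Fin N) 0ℓ} where

    -- An erased edge has an end in `P`, and this end is incident to both sides of the edge.
    Opened⇒Merged : ∀ {L} → Edges L → (∀ {u v} → (u , v) ∈ L → P u ⊎ P v) →
                    Opened L ⇒ EqClosure (Merged P)
    Opened⇒Merged {L} es ends = Glue-min F.isEquivalence (EqC.isEquivalence (Merged P))
      (EqC.return ∘ inj₁) (map sides L) λ p → across (∈-map⁻ sides p)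
      where
      across : ∀ {f g} → (∃[ e ] e ∈ L × (f , g) ≡ sides e) → EqClosure (Merged P) f g
      across ((u , v) , p , refl) with ends p
      ... | inj₁ Pu = EqC.return (inj₂ (u , Pu , Incident-leaving (es p) ,
                                 Incident-arriving (es p)))
      ... | inj₂ Pv = EqC.return (inj₂ (v , Pv , Incident-arriving (rot-sym (es p)) ,
                                 Incident-leaving (rot-sym (es p))))

    -- Rotating around a vertex of `P` crosses its edges one after another, all of them erased, so
    -- all its corners come to lie in one face.
    Merged⇒Opened : ∀ {L} → (∀ {u v} → v ∈ rot u → P u → (u , v) ∈± L) →
                    EqClosure (Merged P) ⇒ Opened L
    Merged⇒Opened {L} covered = EqC.fold (Opened-isEquivalence L) λ
      { (inj₁ f≈g) → Opened-base L f≈g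
      ; (inj₂ (u , Pu , (_ , i) , (_ , j))) → around u Pu i j }
      where
      module O = IsEquivalence (Opened-isEquivalence L)
      rotate : ∀ {u x y} → P u → x ∈ rot u → Star (CyclicNext (rot u)) x y →
               Opened L (left u x) (left u y)
      rotate Pu x∈ ε        = O.refl
      rotate Pu x∈ (n ◅ ns) = O.trans (Opened-∈± (covered x∈ Pu))
        (O.trans (Opened-base L (left-walk n)) (rotate Pu (CyclicNext-∈ʳ n) ns))
      around : ∀ u → P u → ∀ {f g} →
        ((∃[ v ] v ∈ rot u × left u v ≈ f) ⊎ (rot u ≡ [] × at u ≈ f)) →
        ((∃[ v ] v ∈ rot u × left u v ≈ g) ⊎ (rot u ≡ [] × at u ≈ g)) → Opened L f g
      around u Pu (inj₁ (v , v∈ , p)) (inj₁ (w , w∈ , q)) =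
        O.trans (Opened-base L (F.sym p))
          (O.trans (rotate Pu v∈ (CyclicNext-connected v∈ w∈)) (Opened-base L q))
      around u Pu (inj₂ (_ , p)) (inj₂ (_ , q)) = Opened-base L (F.trans (F.sym p) q)
      around u Pu (inj₁ (_ , v∈ , _)) (inj₂ (eq , _)) with () ← subst (_ ∈_) eq v∈
      around u Pu (inj₂ (eq , _)) (inj₁ (_ , v∈ , _)) with () ← subst (_ ∈_) eq v∈

  -- This is V + F ≤ E + C + 1, with V = `N`, at any stage of the erasure. Erasing one more edge
  -- lowers E by one and, by `Bridge`, either raises C or lowers F by at most one, never both; so
  -- the right side minus the left never grows. It is nonnegative at the end, when one face and at
  -- least `N` components are left.
  genus≥0 : ∀ post {pre} → Edges post → Cover pre post →
            ∀ {k c} → Classes (Opened pre) k → Classes (Linked post) c →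
            k + N ≤ suc (length post + c)
  genus≥0 [] {pre} _ cover {k} {c} q r = ≤-trans
    (ℕ.+-mono-≤ (Classes-≤ {l = 1} q one) (Classes-≤ Classes-≡ r)) ≤-refl
    where
    all~ : ∀ f g → Opened pre f g
    all~ f g = Merged⇒Opened {P = λ _ → ⊤} (λ v∈ _ →
      [ id , (λ { (inj₁ ()) ; (inj₂ ()) }) ]′ (cover v∈)) (connected f g)
    one : Classes (Opened pre) 1
    one = record { cls = λ _ → zero ; rep = λ _ → outer ; cls-rep = λ { zero → refl }
                 ; sound = λ _ → refl ; complete = λ _ → all~ _ _ }
  genus≥0 ((u , v) ∷ post) {pre} es cover {k} {c} q r
    with c′ , r′ ← Linked-classes post
    with Classes-Join (Opened-isEquivalence pre) q (left u v) (left v u)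
       | Classes-Join (Linked-isEquivalence post) r′ u v
  ... | inj₁ (_ , q″) | inj₁ (_ , r″) =
    ≤-trans (genus≥0 post (es ∘ there) (Cover-shift cover) q″ r′)
            (s≤s (ℕ.m≤n⇒m≤1+n (ℕ.+-monoʳ-≤ (length post) (Classes-≤ r″ r))))
  ... | inj₁ (_ , q″) | inj₂ (_ , c″ , refl , r″) =
    ≤-trans (genus≥0 post (es ∘ there) (Cover-shift cover) q″ r′)
            (s≤s (≤-trans (≤-reflexive (+-suc (length post) c″))
                          (s≤s (ℕ.+-monoʳ-≤ (length post) (Classes-≤ r″ r)))))
  ... | inj₂ (_ , k″ , refl , q″) | inj₁ (_ , r″) =
    s≤s (≤-trans (genus≥0 post (es ∘ there) (Cover-shift cover) q″ r′)
                 (s≤s (ℕ.+-monoʳ-≤ (length post) (Classes-≤ r″ r))))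
  ... | inj₂ (≁ , _) | inj₂ (u≁v , _) = contradiction (Bridge.one-face (es (here refl)) cover u≁v) ≁

  -- Euler's formula of `G` with the names outside `V` added as isolated vertices, which raises V
  -- and C equally.
  euler-Linked : ∀ {L c} → Edges L → Cover [] L → length L ≡ numEdges → Classes (Linked L) c →
                 suc (length L + c) ≡ numFaces + N
  euler-Linked {L} {c} es cover len q = ℕ.+-cancelʳ-≡ ∣ V ∣ _ _ (begin-equality
    suc (length L + c) + ∣ V ∣          ≡⟨ cong suc (ℕ.+-assoc (length L) c ∣ V ∣) ⟩
    suc (length L + (c + ∣ V ∣))        ≡⟨ cong (λ m → suc (length L + m)) count ⟩
    suc (length L + (numComponents + N)) ≡⟨ cong (λ m → suc (m + (numComponents + N))) len ⟩
    suc (numEdges + (numComponents + N)) ≡⟨ cong suc (ℕ.+-assoc numEdges numComponents N) ⟨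
    suc (numEdges + numComponents) + N   ≡⟨ cong (_+ N) euler ⟨
    ∣ V ∣ + numFaces + N                 ≡⟨ swap₃ ∣ V ∣ numFaces N ⟩
    numFaces + N + ∣ V ∣                 ∎)
    where
    open ≤-Reasoning
    swap₃ : ∀ a b c → a + b + c ≡ b + c + a
    swap₃ = solve-∀
    count : c + ∣ V ∣ ≡ numComponents + N
    count = components-count V (λ v∈ → rot-vertex v∈ , rot-vertex (rot-sym v∈)) es
      (λ v∈ → [ (λ { (inj₁ ()) ; (inj₂ ()) }) , id ]′ (cover v∈))
      q (fromInverse Components components↔)

  private
    shift : ∀ {m n o} → suc m + n ≡ o → m + suc n ≡ o
    shift = trans (+-suc _ _)

  -- The converse bound: erased edges are put back until the graph is `G`, where equality holds.
  -- Since erasing never makes the right side minus the left grow, that difference is at most 0 at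
  -- every stage.
  genus≤0 : ∀ pre {post} → Edges pre → Edges post → Cover pre post →
            length pre + length post ≡ numEdges →
            ∀ {k c} → Classes (Opened pre) k → Classes (Linked post) c →
            suc (length post + c) ≤ k + N
  genus≤0 [] es es′ cover len {k} q r = ≤-trans (≤-reflexive (euler-Linked es′ cover len r))
    (ℕ.+-monoˡ-≤ N (Classes-≤ faceClasses q))
  genus≤0 ((u , v) ∷ pre) {post} es es′ cover len {k} {c} q r
    with k′ , q′ ← Opened-classes pre
    with Classes-Join (Opened-isEquivalence pre) q′ (left u v) (left v u)
       | Classes-Join (Linked-isEquivalence post) r u v
  ... | inj₁ (_ , q″) | inj₁ (_ , r″) = begin
    suc (length post + c)             ≤⟨ ℕ.n≤1+n _ ⟩
    suc (suc (length post) + c)       ≤⟨ genus≤0 pre (es ∘ there)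
      (Edges-∷ (es (here refl)) es′) (Cover-unshift cover) (shift len) q′ r″ ⟩
    k′ + N                            ≤⟨ ℕ.+-monoˡ-≤ N (Classes-≤ q″ q) ⟩
    k + N                             ∎
    where open ≤-Reasoning
  ... | inj₁ (_ , q″) | inj₂ (_ , c″ , refl , r″) = begin
    suc (length post + suc c″)        ≡⟨ cong suc (+-suc (length post) c″) ⟩
    suc (suc (length post) + c″)      ≤⟨ genus≤0 pre (es ∘ there)
      (Edges-∷ (es (here refl)) es′) (Cover-unshift cover) (shift len) q′ r″ ⟩
    k′ + N                            ≤⟨ ℕ.+-monoˡ-≤ N (Classes-≤ q″ q) ⟩
    k + N                             ∎
    where open ≤-Reasoning
  ... | inj₂ (_ , k″ , refl , q″) | inj₁ (_ , r″) = begin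
    suc (length post + c)             ≤⟨ s≤s⁻¹ (genus≤0 pre (es ∘ there)
      (Edges-∷ (es (here refl)) es′) (Cover-unshift cover) (shift len) q′ r″) ⟩
    k″ + N                            ≤⟨ ℕ.+-monoˡ-≤ N (Classes-≤ q″ q) ⟩
    k + N                             ∎
    where open ≤-Reasoning
  ... | inj₂ (≁ , _) | inj₂ (u≁v , _) =
    contradiction (Bridge.one-face (es (here refl)) (Cover-unshift cover) u≁v) ≁

-- Induced embeddings are plane

module Induced {N : ℕ} (G : Embedding N) (plane : IsPlane G) (W : Subset N) where
  open Embedding G
  open IsPlane plane
  open Plane G plane

  private
    module F = Setoid Faces
    module G′ = Embedding (G [ W ])
    module M = IsEquivalence (EqC.isEquivalence (Merged (_∉ˢ W)))

    _~_ : Rel Face 0ℓ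
    _~_ = EqClosure (Merged (_∉ˢ W))

  ≈⇒~ : _≈_ ⇒ _~_
  ≈⇒~ = EqC.return ∘ inj₁

  rot′-∈⁺ : ∀ {u v} → u ∈ˢ W → v ∈ˢ W → v ∈ rot u → v ∈ G′.rot u
  rot′-∈⁺ {u} u∈ v∈ p with u ∈? W
  ... | yes _ = ∈-filter⁺ (_∈? W) p v∈
  ... | no u∉ = contradiction u∈ u∉

  rot′-∈⁻ : ∀ {u v} → v ∈ G′.rot u → u ∈ˢ W × v ∈ˢ W × v ∈ rot u
  rot′-∈⁻ {u} p with u ∈? W
  ... | yes u∈ = u∈ , swap (∈-filter⁻ (_∈? W) p)

  -- The complement of `G′.rot` in `rot`, so that degrees, and with them the numbers of deleted and
  -- kept edges, add up.
  lost : Fin N → List (Fin N)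
  lost u = if does (u ∈? W) then filter (¬? ∘ (_∈? W)) (rot u) else rot u

  lost-∈⁺ : ∀ {u v} → u ∉ˢ W ⊎ v ∉ˢ W → v ∈ rot u → v ∈ lost u
  lost-∈⁺ {u} ends p with u ∈? W
  ... | yes u∈ = ∈-filter⁺ (¬? ∘ (_∈? W)) p ([ contradiction u∈ , id ]′ ends)
  ... | no _   = p

  lost-∈⁻ : ∀ {u v} → v ∈ lost u → (u ∉ˢ W ⊎ v ∉ˢ W) × v ∈ rot u
  lost-∈⁻ {u} p with u ∈? W
  ... | yes _ = let q , v∉ = ∈-filter⁻ (¬? ∘ (_∈? W)) p in inj₂ v∉ , q
  ... | no u∉ = inj₁ u∉ , p

  deleted kept : List (Fin N × Fin N)
  deleted = edges lost
  kept    = edges G′.rot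

  deleted-edges : Edges deleted
  deleted-edges = proj₂ ∘ lost-∈⁻ ∘ ∈-edges⁻ lost

  kept-edges : Edges kept
  kept-edges = proj₂ ∘ proj₂ ∘ rot′-∈⁻ ∘ ∈-edges⁻ G′.rot

  rot′-sym : ∀ {u v} → v ∈ G′.rot u → u ∈ G′.rot v
  rot′-sym p with u∈ , v∈ , q ← rot′-∈⁻ p = rot′-∈⁺ v∈ u∈ (rot-sym q)

  rot′-irrefl : ∀ u → u ∉ G′.rot u
  rot′-irrefl u p = rot-irrefl u (proj₂ (proj₂ (rot′-∈⁻ p)))

  ∈-kept : ∀ {u v} → v ∈ G′.rot u → (u , v) ∈± kept
  ∈-kept = ∈-edges⁺ rot′-irrefl rot′-sym

  ∈-deleted : ∀ {u v} → u ∉ˢ W ⊎ v ∉ˢ W → v ∈ rot u → (u , v) ∈± deleted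
  ∈-deleted ends p = ∈-edges⁺ (λ u q → rot-irrefl u (proj₂ (lost-∈⁻ q)))
    (λ q → let ends , r = lost-∈⁻ q in lost-∈⁺ (Sum.swap ends) (rot-sym r)) (lost-∈⁺ ends p)

  deleted-kept-cover : Cover deleted kept
  deleted-kept-cover {u} {v} p with u ∈? W | v ∈? W
  ... | no u∉  | _      = inj₁ (∈-deleted (inj₁ u∉) p)
  ... | yes _  | no v∉  = inj₁ (∈-deleted (inj₂ v∉) p)
  ... | yes u∈ | yes v∈ = inj₂ (∈-kept (rot′-∈⁺ u∈ v∈ p))

  length-deleted-kept : length deleted + length kept ≡ numEdges
  length-deleted-kept = trans (cong₂ _+_ (length-edges lost) (length-edges G′.rot))
    (trans (sum-map-+ _ _ (allFin N)) (cong sum (map-cong degrees (allFin N))))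
    where
    degrees : ∀ u → length (filter (u <?_) (lost u)) + length (filter (u <?_) (G′.rot u)) ≡
                    length (filter (u <?_) (rot u))
    degrees u with u ∈? W
    ... | yes _ = length-filter-split (u <?_) (_∈? W) (rot u)
    ... | no _  = ℕ.+-identityʳ _

  erase-nbr : ∀ {u x} → x ∈ rot u → x ∉ˢ W → left u x ~ left x u
  erase-nbr x∈ x∉ = EqC.return
    (inj₂ (_ , x∉ , Incident-arriving (rot-sym x∈) , Incident-leaving (rot-sym x∈)))

  left-walk′ : ∀ {u v w} → CyclicNext (G′.rot v) u w → left u v ~ left v w
  left-walk′ {v = v} n with v ∈? W
  ... | no _  = contradiction n CyclicNext-[]
  ... | yes _ = CyclicNext-filter (EqC.isEquivalence _) (λ x → left x v) (left v) (_∈? W) (rot v)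
    (≈⇒~ ∘ left-walk) erase-nbr n

  at-corner : ∀ u → (∃[ v ] v ∈ rot u × G′.at u ≡ left u v) ⊎ (rot u ≡ [] × G′.at u ≡ at u)
  at-corner u with rot u
  ... | []    = inj₂ (refl , refl)
  ... | v ∷ _ = inj₁ (v , here refl , refl)

  rot′-[] : ∀ {u} → (∀ {x} → x ∈ rot u → x ∉ˢ W) → G′.rot u ≡ []
  rot′-[] {u} none with u ∈? W
  ... | yes _ = filter-none (_∈? W) (All.tabulate none)
  ... | no _  = refl

  -- The first kept neighbour met on the way to `y` serves as `w`: every neighbour passed before it
  -- is erased and merges the corners on its two sides.
  rotate-to-kept : ∀ {u x y} → u ∈ˢ W → y ∈ˢ W → x ∈ rot u → Star (CyclicNext (rot u)) x y →
                   ∃[ w ] w ∈ G′.rot u × left u w ~ left u x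
  rotate-to-kept u∈W y∈W x∈ ε = _ , rot′-∈⁺ u∈W y∈W x∈ , M.refl
  rotate-to-kept {x = x} u∈W y∈W x∈ (n ◅ ns) with x ∈? W
  ... | yes x∈W = x , rot′-∈⁺ u∈W x∈W x∈ , M.refl
  ... | no x∉ with w , w∈ , w~ ← rotate-to-kept u∈W y∈W (CyclicNext-∈ʳ n) ns =
    w , w∈ , M.trans w~ (M.sym (M.trans (erase-nbr x∈ x∉) (≈⇒~ (left-walk n))))

  rotate-erased : ∀ {u x y} → (∀ {x} → x ∈ rot u → x ∉ˢ W) → x ∈ rot u →
                  Star (CyclicNext (rot u)) x y → left u x ~ left u y
  rotate-erased none x∈ ε        = M.refl
  rotate-erased none x∈ (n ◅ ns) = M.trans (erase-nbr x∈ (none x∈))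
    (M.trans (≈⇒~ (left-walk n)) (rotate-erased none (CyclicNext-∈ʳ n) ns))

  -- A corner at a kept vertex merges into a corner at a kept neighbour or, if there is no such
  -- neighbour, into the face recorded by `G′.at`.
  Incident⁺ : ∀ {u f g} → u ∈ˢ W → Incident u f → f ~ g → G′.Incident u g
  Incident⁺ {u} u∈W (u∈V , inj₂ (eq , at≈)) f~g with at-corner u
  ... | inj₁ (_ , v∈ , _) with () ← subst (_ ∈_) eq v∈
  ... | inj₂ (_ , at≡) = x∈p∩q⁺ (u∈V , u∈W) ,
    inj₂ (rot′-[] (λ x∈ → contradiction (subst (_ ∈_) eq x∈) λ ()) ,
          M.trans (≈⇒~ (F.trans (F.reflexive at≡) at≈)) f~g)
  Incident⁺ {u} u∈W (u∈V , inj₁ (v , v∈ , left≈)) f~g with any? (_∈? W) (rot u)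
  ... | yes p with y , y∈ , y∈W ← find p
    with w , w∈ , w~ ← rotate-to-kept u∈W y∈W v∈ (CyclicNext-connected v∈ y∈) =
    x∈p∩q⁺ (u∈V , u∈W) , inj₁ (w , w∈ , M.trans w~ (M.trans (≈⇒~ left≈) f~g))
  ... | no ¬p with none ← (λ {x} (x∈ : x ∈ rot u) (x∈W : x ∈ˢ W) → ¬p (lose x∈ x∈W))
    with at-corner u
  ...   | inj₂ (eq , _) with () ← subst (_ ∈_) eq v∈
  ...   | inj₁ (v₀ , v₀∈ , at≡) = x∈p∩q⁺ (u∈V , u∈W) , inj₂ (rot′-[] none ,
    M.trans (≈⇒~ (F.reflexive at≡))
      (M.trans (rotate-erased none v₀∈ (CyclicNext-connected v₀∈ v∈)) (M.trans (≈⇒~ left≈) f~g)))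

  -- A link through a kept vertex survives; one through an erased vertex becomes an identity of
  -- faces.
  connected′ : ∀ f g → EqClosure (G′.Merged (λ _ → ⊤)) f g
  connected′ f g = EqC.fold (EqC.isEquivalence _) (λ where
    (inj₁ f≈g)           → EqC.return (inj₁ (≈⇒~ f≈g))
    (inj₂ (u , _ , i , j)) → share u i j) (connected f g)
    where
    share : ∀ u {f g} → Incident u f → Incident u g → EqClosure (G′.Merged (λ _ → ⊤)) f g
    share u i j with u ∈? W
    ... | yes u∈ = EqC.return (inj₂ (u , tt , Incident⁺ u∈ i M.refl , Incident⁺ u∈ j M.refl))
    ... | no u∉  = EqC.return (inj₁ (EqC.return (inj₂ (u , u∉ , i , j))))

  rot′-ends : ∀ {u v} → v ∈ G′.rot u → u ∈ˢ G′.V × v ∈ˢ G′.V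
  rot′-ends p with u∈ , v∈ , q ← rot′-∈⁻ p =
    x∈p∩q⁺ (rot-vertex q , u∈) , x∈p∩q⁺ (rot-vertex (rot-sym q) , v∈)

  -- Merging at erased vertices unites the same faces as opening the edges in `deleted`, and for a
  -- list of edges a finite count is available.
  faces′ : ∃ (Classes _~_)
  faces′ with k , q ← Opened-classes deleted = k , Classes-resp
    (Opened⇒Merged deleted-edges (proj₁ ∘ lost-∈⁻ ∘ ∈-edges⁻ lost))
    (Merged⇒Opened (λ v∈ u∉ → ∈-deleted (inj₁ u∉) v∈)) q

  components′ : ∃ (Classes (Setoid._≈_ G′.Components))
  components′ = components-exist G′.V rot′-ends (∈-edges⁻ G′.rot) ∈-kept

  -- The two genus bounds give equality with `N` as vertex number; the component count then
  -- exchanges `N` for the number of kept vertices.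
  euler′ : ∣ G′.V ∣ + proj₁ faces′ ≡ suc (G′.numEdges + proj₁ components′)
  euler′ with c , q ← Linked-classes kept = ℕ.+-cancelʳ-≡ N _ _ (begin-equality
    ∣ G′.V ∣ + proj₁ faces′ + N             ≡⟨ ℕ.+-assoc ∣ G′.V ∣ _ N ⟩
    ∣ G′.V ∣ + (proj₁ faces′ + N)           ≡⟨ cong (∣ G′.V ∣ +_) (ℕ.≤-antisym
      (genus≥0 kept kept-edges deleted-kept-cover opened q)
      (genus≤0 deleted deleted-edges kept-edges deleted-kept-cover length-deleted-kept opened q)) ⟩
    ∣ G′.V ∣ + suc (length kept + c)        ≡⟨ rearrange ∣ G′.V ∣ (length kept) c ⟩
    suc (length kept + (c + ∣ G′.V ∣))      ≡⟨ cong₂ (λ a b → suc (a + b)) (length-edges G′.rot)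
      (components-count G′.V rot′-ends (∈-edges⁻ G′.rot) ∈-kept q (proj₂ components′)) ⟩
    suc (G′.numEdges + (proj₁ components′ + N)) ≡⟨ cong suc (ℕ.+-assoc G′.numEdges _ N) ⟨
    suc (G′.numEdges + proj₁ components′) + N   ∎)
    where
    open ≤-Reasoning
    opened = proj₂ (Opened-classes deleted)
    rearrange : ∀ a b c → a + suc (b + c) ≡ suc (b + (c + a))
    rearrange = solve-∀

  isPlane : IsPlane (G [ W ])
  isPlane = record
    { rot-unique    = unique
    ; rot-irrefl    = rot′-irrefl
    ; rot-sym       = rot′-sym
    ; rot-vertex    = proj₁ ∘ rot′-ends
    ; left-walk     = left-walk′
    ; connected     = connected′
    ; numFaces      = proj₁ faces′
    ; faces↔        = toInverse G′.Faces (proj₂ faces′)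
    ; numComponents = proj₁ components′
    ; components↔   = toInverse G′.Components (proj₂ components′)
    ; euler         = euler′
    }
    where
    unique : ∀ u → Unique (G′.rot u)
    unique u with u ∈? W
    ... | yes _ = Unique.filter⁺ (_∈? W) (rot-unique u)
    ... | no _  = []

-- Removing one point from a finite subset

x∉p-x : ∀ {n} (p : Subset n) x → x ∉ˢ p - x
x∉p-x (_ ∷ p) (suc x) (there q) = x∉p-x p x q
x∉p-x (inside ∷ p)  zero ()
x∉p-x (outside ∷ p) zero ()

∣p∣≤1+∣p-x∣ : ∀ {n} (p : Subset n) x → ∣ p ∣ ≤ suc ∣ p - x ∣
∣p∣≤1+∣p-x∣ (inside  ∷ p) zero    = s≤s (≤-reflexive (cong ∣_∣ (sym (p─⊥≡p p))))
∣p∣≤1+∣p-x∣ (outside ∷ p) zero    = ℕ.m≤n⇒m≤1+n (≤-reflexive (cong ∣_∣ (sym (p─⊥≡p p))))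
∣p∣≤1+∣p-x∣ (inside  ∷ p) (suc x) = s≤s (∣p∣≤1+∣p-x∣ p x)
∣p∣≤1+∣p-x∣ (outside ∷ p) (suc x) = ∣p∣≤1+∣p-x∣ p x

-- Selecting the vertices to delete

module Outerplane {N : ℕ} (G : Embedding N) (plane : IsPlane G) where
  open Embedding G
  open IsPlane plane
  open Plane G plane

  private
    module F = Setoid Faces

    -- nothing stands for an extra vertex placed in the outer face.
    Node : Set
    Node = Maybe (Fin N)

    variable
      S : Subset N
      D : List (Fin N)
      u v w : Fin N
      x y : Node

  On : Node → Face → Set
  On nothing  f = outer ≈ f
  On (just u) f = Incident u f

  On-resp : ∀ x {f g} → f ≈ g → On x f → On x g
  On-resp nothing  f≈g p = F.trans p f≈g
  On-resp (just u) f≈g (u∈ , inj₁ (v , v∈ , p)) = u∈ , inj₁ (v , v∈ , F.trans p f≈g)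
  On-resp (just u) f≈g (u∈ , inj₂ (eq , p))     = u∈ , inj₂ (eq , F.trans p f≈g)

  Share : Rel Node 0ℓ
  Share x y = ∃[ f ] On x f × On y f

  In : Subset N → Node → Set
  In S nothing  = ⊤
  In S (just u) = u ∈ˢ S

  Tie : Subset N → Node × Node → Set
  Tie S (x , y) = In S x × In S y × Share x y × (x ≢ y ⊎ x ≡ nothing)

  insert : Fin N → Subset N → Subset N
  insert v S = ⁅ v ⁆ ∪ S

  In-insert⁺ : ∀ {x} → In S x → In (insert v S) x
  In-insert⁺ {x = nothing} _ = tt
  In-insert⁺ {x = just _}  p = q⊆p∪q _ _ p

  In-insert⁻ : ∀ {S v x} → In (insert v S) x → x ≡ just v ⊎ In S x
  In-insert⁻ {x = nothing} _ = inj₂ tt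
  In-insert⁻ {S = S} {v = v} {x = just _} p =
    Sum.map₁ (cong just ∘ x∈⁅y⁆⇒x≡y _) (x∈p∪q⁻ ⁅ v ⁆ S p)

  ∣insert∣ : v ∉ˢ S → suc ∣ S ∣ ≤ ∣ insert v S ∣
  ∣insert∣ {v} v∉ = p⊂q⇒∣p∣<∣q∣ (q⊆p∪q _ _ , v , p⊆p∪q _ (x∈⁅x⁆ v) , v∉)

  data Grown : Subset N → Set where
    start : Grown ⊥
    grow  : Grown S → v ∉ˢ S → Tie S (x , y) → Share (just v) x → Share (just v) y →
            Grown (insert v S)

  InD : List (Fin N) → Node → Set
  InD D nothing  = ⊤
  InD D (just u) = u ∈ D

  InD-there : ∀ x → InD D x → InD (v ∷ D) x
  InD-there nothing  _ = tt
  InD-there (just _) p = there p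

  Reached : List (Fin N) → Fin N → Set
  Reached D u = ∃[ x ] InD D x × Share (just u) x

  Reached-there : Reached D u → Reached (v ∷ D) u
  Reached-there (x , p , s) = x , InD-there x p , s

  -- Connectedness of the selected set together with the extra vertex: each entry shares a face with
  -- that vertex or with a later entry of the list.
  data Tree : List (Fin N) → Set where
    []  : Tree []
    _∷_ : Reached D v → Tree D → Tree (v ∷ D)

  Hit : List (Fin N) → Node × Node → Set
  Hit D (x , y) = InD D x ⊎ InD D y

  Hit-there : ∀ {e} → Hit D e → Hit (v ∷ D) e
  Hit-there {e = x , y} = Sum.map (InD-there x) (InD-there y)

  -- `chosen` may repeat vertices; bounding its length bounds the set all the more.
  record Selection (S : Subset N) (ties : List (Node × Node)) : Set where
    constructor selection
    field
      {chosen} : List (Fin N)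
      tree     : Tree chosen
      reached  : ∀ {u} → u ∈ˢ S → Reached chosen u
      hits     : All (Hit chosen) ties
      size     : 2 * length chosen ≤ ∣ S ∣ + length ties

  -- Ties at `v` are recorded by their other ends `nbrs`. They can be hit in two ways, by `v` alone
  -- or by all of `nbrs`, and `hits` serves both.
  record Split (S : Subset N) (v : Fin N) (ties : List (Node × Node)) : Set where
    constructor split
    field
      {nbrs}    : List Node
      {rest}    : List (Node × Node)
      nbrs-near : All (λ x → In S x × Share (just v) x) nbrs
      rest-ties : All (Tie S) rest
      count     : length nbrs + length rest ≡ length ties
      hits      : ∀ {D} → v ∈ D ⊎ All (InD D) nbrs → All (Hit D) rest → All (Hit D) ties

  split-ties : ∀ {ties} → All (Tie (insert v S)) ties → Split S v ties
  split-ties [] = split [] [] refl λ _ _ → []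
  split-ties ((x∈ , y∈ , s , x≢y) ∷ ts)
    with split nbrs rest eq hits ← split-ties ts with In-insert⁻ x∈ | In-insert⁻ y∈
  ... | inj₁ refl | inj₁ refl = contradiction refl ([ id , (λ ()) ]′ x≢y)
  ... | inj₁ refl | inj₂ y∈S  = split ((y∈S , s) ∷ nbrs) rest (cong suc eq) λ where
    (inj₁ v∈)       r → inj₁ v∈ ∷ hits (inj₁ v∈) r
    (inj₂ (p ∷ ps)) r → inj₂ p ∷ hits (inj₂ ps) r
  ... | inj₂ x∈S  | inj₁ refl =
    split ((x∈S , proj₁ s , swap (proj₂ s)) ∷ nbrs) rest (cong suc eq) λ where
    (inj₁ v∈)       r → inj₂ v∈ ∷ hits (inj₁ v∈) r
    (inj₂ (p ∷ ps)) r → inj₁ p ∷ hits (inj₂ ps) r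
  ... | inj₂ x∈S  | inj₂ y∈S  = split nbrs ((x∈S , y∈S , s , x≢y) ∷ rest)
    (trans (+-suc _ _) (cong suc eq)) λ { h (r ∷ rs) → r ∷ hits h rs }

  select : Grown S → ∀ {ties} → All (Tie S) ties → Selection S ties
  select start ties = selection [] (λ u∈ → contradiction u∈ ∉⊥) (All.map hit ties) z≤n
    where
    hit : ∀ {e} → Tie ⊥ e → Hit [] e
    hit {nothing , _}      _        = inj₁ tt
    hit {just _ , nothing} _        = inj₂ tt
    hit {just _ , just _}  (u∈ , _) = contradiction u∈ ∉⊥
  select (grow {S} {v} {x} {y} S-grown v∉ tie vx vy) {ties} ts with split-ties ts
  -- Demanding the tie of `x` and `y` forces an end of it into the selection, which reaches `v`. Its
  -- cost of one is covered by the new vertex.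
  ... | split {[]} {rest} nbrs rest-ties eq hits
    with selection {D} tree reached (h ∷ hs) size ← select S-grown (tie ∷ rest-ties) =
    selection tree reached′ (hits (inj₂ []) hs) (begin
      2 * length D              ≤⟨ size ⟩
      ∣ S ∣ + suc (length rest) ≡⟨ +-suc ∣ S ∣ _ ⟩
      suc ∣ S ∣ + length rest   ≤⟨ ℕ.+-mono-≤ (∣insert∣ v∉) (≤-reflexive eq) ⟩
      ∣ insert v S ∣ + length ties ∎)
    where
    open ≤-Reasoning
    reached′ : ∀ {u} → u ∈ˢ insert v S → Reached D u
    reached′ u∈ with In-insert⁻ {x = just _} u∈
    ... | inj₁ refl = [ (λ p → x , p , vx) , (λ p → y , p , vy) ]′ h
    ... | inj₂ u∈S  = reached u∈S
  -- The only tie at `v` ends at the extra vertex, which hits the tie and reaches `v` without any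
  -- addition.
  ... | split {nothing ∷ []} {rest} ((_ , s) ∷ []) rest-ties eq hits
    with selection {D} tree reached hs size ← select S-grown rest-ties =
    selection tree reached′ (hits (inj₂ (tt ∷ [])) hs) (begin
      2 * length D                 ≤⟨ size ⟩
      ∣ S ∣ + length rest          ≤⟨ ℕ.+-mono-≤ (ℕ.<⇒≤ (∣insert∣ v∉))
        (≤-trans (ℕ.n≤1+n _) (≤-reflexive eq)) ⟩
      ∣ insert v S ∣ + length ties ∎)
    where
    open ≤-Reasoning
    reached′ : ∀ {u} → u ∈ˢ insert v S → Reached D u
    reached′ u∈ with In-insert⁻ {x = just _} u∈
    ... | inj₁ refl = nothing , tt , s
    ... | inj₂ u∈S  = reached u∈S
  -- Adding `w`, already attached to the tree, hits the only tie at `v` and reaches `v`. The cost of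
  -- two is covered by `v` and the dropped tie.
  ... | split {just w ∷ []} {rest} ((w∈ , s) ∷ []) rest-ties eq hits
    with selection {D} tree reached hs size ← select S-grown rest-ties =
    selection (reached w∈ ∷ tree) reached′
      (hits (inj₂ (here refl ∷ [])) (All.map Hit-there hs)) (begin
      2 * suc (length D)           ≡⟨ ℕ.*-suc 2 (length D) ⟩
      2 + 2 * length D             ≤⟨ ℕ.+-monoʳ-≤ 2 size ⟩
      2 + (∣ S ∣ + length rest)    ≡⟨ cong suc (+-suc ∣ S ∣ (length rest)) ⟨
      suc ∣ S ∣ + suc (length rest) ≤⟨ ℕ.+-mono-≤ (∣insert∣ v∉) (≤-reflexive eq) ⟩
      ∣ insert v S ∣ + length ties ∎)
    where
    open ≤-Reasoning
    reached′ : ∀ {u} → u ∈ˢ insert v S → Reached (w ∷ D) u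
    reached′ u∈ with In-insert⁻ {x = just _} u∈
    ... | inj₁ refl = just w , here refl , s
    ... | inj₂ u∈S  = Reached-there (reached u∈S)
  -- Adding `v` hits all its ties, and the tie demanded in return attaches `v` to the tree. At least
  -- two ties are dropped, one is added and one vertex is gained, which covers the cost of two.
  ... | split {_ ∷ _ ∷ nbrs} {rest} _ rest-ties eq hits
    with selection {D} tree reached (h ∷ hs) size ← select S-grown (tie ∷ rest-ties) =
    selection (v-reached ∷ tree) reached′ (hits (inj₁ (here refl)) (All.map Hit-there hs)) (begin
      2 * suc (length D)              ≡⟨ ℕ.*-suc 2 (length D) ⟩
      2 + 2 * length D                ≤⟨ ℕ.+-monoʳ-≤ 2 size ⟩
      2 + (∣ S ∣ + suc (length rest)) ≡⟨ rearrange ∣ S ∣ (length rest) ⟩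
      suc ∣ S ∣ + (2 + length rest)   ≤⟨ ℕ.+-mono-≤ (∣insert∣ v∉)
        (≤-trans (s≤s (s≤s (ℕ.m≤n+m (length rest) (length nbrs)))) (≤-reflexive eq)) ⟩
      ∣ insert v S ∣ + length ties ∎)
    where
    open ≤-Reasoning
    rearrange : ∀ a b → 2 + (a + suc b) ≡ suc a + (2 + b)
    rearrange = solve-∀
    v-reached : Reached D v
    v-reached = [ (λ p → x , p , vx) , (λ p → y , p , vy) ]′ h
    reached′ : ∀ {u} → u ∈ˢ insert v S → Reached (v ∷ D) u
    reached′ u∈ with In-insert⁻ {x = just _} u∈
    ... | inj₁ refl = Reached-there v-reached
    ... | inj₂ u∈S  = Reached-there (reached u∈S)

  -- Growing the vertex order up to all of `V`

  parent : Grown S → u ∈ˢ S → ∃[ x ] In S x × x ≢ just u × Share (just u) x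
  parent start u∈ = contradiction u∈ ∉⊥
  parent (grow {v = v} {x = x} S-grown v∉ (x∈ , _) vx _) u∈ with In-insert⁻ {x = just _} u∈
  ... | inj₁ refl = x , In-insert⁺ {x = x} x∈ , (λ { refl → v∉ x∈ }) , vx
  ... | inj₂ u∈S with p , p∈ , p≢u , s ← parent S-grown u∈S = p , In-insert⁺ {x = p} p∈ , p≢u , s

  Growth : Subset N → Set
  Growth S = ∃[ v ] v ∈ˢ V × v ∉ˢ S × ∃₂ λ x y → Tie S (x , y) × Share (just v) x × Share (just v) y

  attach : ∀ {f} → In S x → In S y → x ≢ y ⊎ x ≡ nothing →
           On x f → On y f → v ∉ˢ S → Incident v f → Growth S
  attach {f = f} x∈ y∈ x≢y p q v∉ i =
    _ , proj₁ i , v∉ , _ , _ , (x∈ , y∈ , (f , p , q) , x≢y) , (f , i , p) , (f , i , q)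

  -- Rotating around s towards a face with a second grown vertex, the common
  -- neighbour of two consecutive faces is either such a vertex or not grown.
  rotate-growth : ∀ {s g} → s ∈ˢ S → In S x → x ≢ just s → On x g →
    ∀ {a b} → a ∈ rot s → Star (CyclicNext (rot s)) a b → left s b ≈ g →
    v ∉ˢ S → Incident v (left s a) → Growth S
  rotate-growth {x = x} s∈ x∈ x≢s xg a∈ ε ~g v∉ i =
    attach {x = just _} {y = x} s∈ x∈ (inj₁ (x≢s ∘ sym)) (Incident-leaving a∈)
      (On-resp x (F.sym ~g) xg) v∉ i
  rotate-growth {S = S} {s = s} s∈ x∈ x≢s xg {a} a∈ (n ◅ ns) ~g v∉ i with a ∈? S
  ... | yes a∈S = attach {x = just s} {y = just a} s∈ a∈S (inj₁ λ { refl → rot-irrefl s a∈ })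
    (Incident-leaving a∈) (Incident-arriving (rot-sym a∈)) v∉ i
  -- The face of the next corner also contains `a`, which takes the place of `v` as the vertex to be
  -- added.
  ... | no a∉S = rotate-growth s∈ x∈ x≢s xg (CyclicNext-∈ʳ n) ns ~g a∉S
    (On-resp (just a) (left-walk n) (Incident-leaving (rot-sym a∈)))

  -- At the extra vertex its loop serves as the tie. At a grown vertex `s`, rotation leads from `f`
  -- to a face shared with a second grown node.
  growth-at : ∀ {f} → Grown S → In S x → On x f → v ∉ˢ S → Incident v f → Growth S
  growth-at {x = nothing} _ _ xf v∉ i =
    attach {x = nothing} {y = nothing} tt tt (inj₂ refl) xf xf v∉ i
  growth-at {x = just s} {v = v} S-grown s∈ sf v∉ i
    -- The second node is one that `s` was attached to when it was added.
    with p , p∈ , p≢s , g , sg , pg ← parent S-grown s∈ with sf | sg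
  ... | _ , inj₁ (a , a∈ , ~f) | _ , inj₁ (b , b∈ , ~g) =
    rotate-growth s∈ p∈ p≢s pg a∈ (CyclicNext-connected a∈ b∈) ~g v∉ (On-resp (just v) (F.sym ~f) i)
  -- An isolated vertex lies on a single face, so `p` is on `f` as well.
  ... | _ , inj₂ (_ , ~f) | _ , inj₂ (_ , ~g) =
    attach {x = just s} {y = p} s∈ p∈ (inj₁ (p≢s ∘ sym)) sf
      (On-resp p (F.trans (F.sym ~g) ~f) pg) v∉ i
  ... | _ , inj₁ (_ , a∈ , _) | _ , inj₂ (eq , _) = contradiction (subst (_ ∈_) eq a∈) λ ()
  ... | _ , inj₂ (eq , _) | _ , inj₁ (_ , b∈ , _) = contradiction (subst (_ ∈_) eq b∈) λ ()

  Touched : Subset N → Face → Set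
  Touched S f = ∃[ x ] In S x × On x f

  -- Along the chain of faces, a linking vertex that is grown touches the next face; the first one
  -- that is not can be handed to `growth-at`.
  spread : Grown S → ∀ {f g} → EqClosure (Merged (λ _ → ⊤)) f g →
           Touched S f → Growth S ⊎ Touched S g
  spread S-grown ε t = inj₂ t
  spread {S} S-grown (st ◅ sts) t = [ inj₁ , spread S-grown sts ]′ (one (unsym st) t)
    where
    unsym : ∀ {f g} → SymClosure (Merged (λ _ → ⊤)) f g →
            f ≈ g ⊎ (∃[ u ] Incident u f × Incident u g)
    unsym (fwd (inj₁ p))               = inj₁ p
    unsym (bwd (inj₁ p))               = inj₁ (F.sym p)
    unsym (fwd (inj₂ (u , _ , i , j))) = inj₂ (u , i , j)
    unsym (bwd (inj₂ (u , _ , i , j))) = inj₂ (u , j , i)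
    one : ∀ {f g} → f ≈ g ⊎ (∃[ u ] Incident u f × Incident u g) →
          Touched S f → Growth S ⊎ Touched S g
    one (inj₁ p) (x , x∈ , xf) = inj₂ (x , x∈ , On-resp x p xf)
    one (inj₂ (u , i , j)) (x , x∈ , xf) with u ∈? S
    ... | yes u∈ = inj₂ (just u , u∈ , j)
    ... | no u∉  = inj₁ (growth-at {x = x} S-grown x∈ xf u∉ i)

  incident-face : v ∈ˢ V → ∃ (Incident v)
  incident-face {v} v∈ with rot v
  ... | []    = at v , v∈ , inj₂ (refl , F.refl)
  ... | w ∷ _ = left v w , v∈ , inj₁ (w , here refl , F.refl)

  growth : Grown S → v ∈ˢ V → v ∉ˢ S → Growth S
  growth S-grown v∈ v∉ with g , i ← incident-face v∈
    with spread S-grown (connected outer g) (nothing , tt , F.refl)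
  ... | inj₁ gr             = gr
  ... | inj₂ (x , x∈ , xg) = growth-at {x = x} S-grown x∈ xg v∉ i

  -- `m` bounds the number of vertices still missing and makes the recursion structural.
  grow-all : ∀ m → Grown S → S ⊆ V → ∣ V ∣ ≤ m + ∣ S ∣ → ∃[ S′ ] Grown S′ × S′ ⊆ V × V ⊆ S′
  grow-all {S} m S-grown S⊆V bound with Fin.any? (λ v → v ∈? V ×-dec ¬? (v ∈? S))
  ... | no none = S , S-grown , S⊆V , λ {v} v∈ → decidable-stable (v ∈? S) λ v∉ → none (v , v∈ , v∉)
  ... | yes (v , v∈ , v∉) with m
  ...   | zero  = contradiction bound (ℕ.<⇒≱ (p⊂q⇒∣p∣<∣q∣ (S⊆V , v , v∈ , v∉)))
  ...   | suc m with u , u∈ , u∉ , _ , _ , tie , s , t ← growth S-grown v∈ v∉ =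
    grow-all m (grow S-grown u∉ tie s t)
      (λ w∈ → [ (λ { refl → u∈ }) , S⊆V ]′ (In-insert⁻ {x = just _} w∈))
      (≤-trans bound (≤-trans (≤-reflexive (sym (+-suc m ∣ S ∣))) (ℕ.+-monoʳ-≤ m (∣insert∣ u∉))))

  -- Deleting the selected vertices

  Tree-outer : ∀ {P : Pred (Fin N) 0ℓ} → Tree D → (∀ {d} → d ∈ D → P d) →
               ∀ x {f} → InD D x → On x f → EqClosure (Merged P) outer f
  Tree-outer _ _ nothing _ p = EqC.return (inj₁ p)
  -- Erasing `d` merges all faces at `d`, among them the face shared with its predecessor `y`, which
  -- is linked to the outer face by induction.
  Tree-outer {P = P} ((y , y∈ , g , ig , yg) ∷ tree) D⊆P (just d) (here refl) i =
    EqC.transitive (Merged P) (Tree-outer tree (D⊆P ∘ there) y y∈ yg)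
      (EqC.return (inj₂ (d , D⊆P (here refl) , ig , i)))
  Tree-outer (_ ∷ tree) D⊆P (just d) (there d∈) i = Tree-outer tree (D⊆P ∘ there) (just d) d∈ i

  erase : List (Fin N) → Subset N
  erase = foldr (λ d p → p - d) V

  ∣erase∣ : ∀ D → ∣ V ∣ ≤ length D + ∣ erase D ∣
  ∣erase∣ []      = ≤-refl
  ∣erase∣ (d ∷ D) = begin
    ∣ V ∣                              ≤⟨ ∣erase∣ D ⟩
    length D + ∣ erase D ∣             ≤⟨ ℕ.+-monoʳ-≤ (length D) (∣p∣≤1+∣p-x∣ (erase D) d) ⟩
    length D + suc ∣ erase D - d ∣     ≡⟨ +-suc (length D) _ ⟩
    suc (length D + ∣ erase D - d ∣)   ∎
    where open ≤-Reasoning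

  erase⊆V : ∀ D → erase D ⊆ V
  erase⊆V []      u∈ = u∈
  erase⊆V (d ∷ D) u∈ = erase⊆V D (p─q⊆p (erase D) ⁅ d ⁆ u∈)

  ∉-erase : ∀ {d} → d ∈ D → d ∉ˢ erase D
  ∉-erase {D = d ∷ D} (here refl) p = x∉p-x (erase D) d p
  ∉-erase {D = d ∷ D} (there d∈)  p = ∉-erase d∈ (p─q⊆p (erase D) ⁅ d ⁆ p)

  large-outerplane : ∃[ W ] W ⊆ V × ∣ V ∣ ≤ 2 * ∣ W ∣ × IsOuterplane (G [ W ])
  large-outerplane
    with S , S-grown , S⊆V , V⊆S ← grow-all ∣ V ∣ start (⊥⊆ {p = V}) (ℕ.m≤m+n ∣ V ∣ _)
    -- With no ties demanded, the size bound reads 2|D| ≤ |S|.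
    with selection {D} tree reached [] size ← select S-grown [] =
    erase D , erase⊆V D , bound , isPlane , on-outer
    where
    open Induced G plane (erase D)
    on-outer : ∀ v → v ∈ˢ V ∩ erase D → Embedding.Incident (G [ erase D ]) v outer
    on-outer v v∈ with v∈V , v∈W ← x∈p∩q⁻ V (erase D) v∈
      with x , x∈ , f , i , xf ← reached (V⊆S v∈V) =
      -- The face `f` that `v` shares with a selected node or with the extra vertex merges into the
      -- outer face.
      Incident⁺ v∈W i (EqC.symmetric (Merged (_∉ˢ erase D)) (Tree-outer tree ∉-erase x x∈ xf))
    bound : ∣ V ∣ ≤ 2 * ∣ erase D ∣
    -- Adding |V| on both sides avoids subtraction: 2|V| ≤ 2|D| + 2|W| ≤ |V| + 2|W|, where W is
    -- `erase D`.
    bound = ℕ.+-cancelˡ-≤ ∣ V ∣ _ _ (begin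
      ∣ V ∣ + ∣ V ∣                     ≡⟨ double ∣ V ∣ ⟩
      2 * ∣ V ∣                         ≤⟨ ℕ.*-monoʳ-≤ 2 (∣erase∣ D) ⟩
      2 * (length D + ∣ erase D ∣)      ≡⟨ ℕ.*-distribˡ-+ 2 (length D) _ ⟩
      2 * length D + 2 * ∣ erase D ∣    ≤⟨ ℕ.+-monoˡ-≤ _
        (≤-trans size (≤-reflexive (ℕ.+-identityʳ ∣ S ∣))) ⟩
      ∣ S ∣ + 2 * ∣ erase D ∣           ≤⟨ ℕ.+-monoˡ-≤ _ (p⊆q⇒∣p∣≤∣q∣ S⊆V) ⟩
      ∣ V ∣ + 2 * ∣ erase D ∣           ∎)
      where
      open ≤-Reasoning
      double : ∀ a → a + a ≡ 2 * a
      double = solve-∀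

theorem2 : ∀ {N : ℕ} (G : Embedding N) → IsPlane G →
    ∀ (n : ℕ) → ∣ Embedding.V G ∣ ≡ n →
    ∃[ V′ ] V′ ⊆ Embedding.V G × n ≤ 2 * ∣ V′ ∣ × IsOuterplane (G [ V′ ])
theorem2 G plane _ refl = Outerplane.large-outerplane G plane
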